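{- Let $q$ be a prime power and $m,n$ positive integers with $\max\{m,n\}>1$. Suppose $f(X)\in\mathbb{F}_q[X]$ is uniquely $(m,n)$-decomposable as $f(X)=g(X)^m h\!\left(\frac{X^n}{g(X)}\right)$. Then the number of matrices $T\in\mathrm{TSR}(m,n;q)$ with $\det(XI_{mn}-T)=f(X)$ equals $N_\chi(h(X))$, the number of matrices in $\operatorname{M}_m(\mathbb{F}_q)$ whose characteristic polynomial is $h(X)$.
   Context: An $(m,n)$-TSR matrix over $\mathbb{F}_q$ is a matrix $T\in \operatorname{M}_{mn}(\mathbb{F}_q)$ which, viewed as an $n\times n$ array of $m\times m$ blocks, has $I_m$ in block positions $(i+1,i)$ for $1\le i\le n-1$, has last block column $(c_0B,\dots,c_{n-1}B)^{T}$ (top to bottom) for some $c_i\in\mathbb{F}_q$ and $B\in \operatorname{M}_m(\mathbb{F}_q)$, and all other blocks zero; $\mathrm{TSR}(m,n;q)$ is the set of these. An $(m,n)$-decomposition of $f(X)\in\mathbb{F}_q[X]$ is an expression $f(X)=g(X)^m h\!\left(X^n/g(X)\right)$ where $h(X)\in\mathbb{F}_q[X]$ is monic of degree $m$ with $h(0)\ne 0$ and $g(X)\in\mathbb{F}_q[X]$ (not necessarily monic) has degree at most $n-1$ and $g(0)=1$. $f$ is $(m,n)$-decomposable if it has such a decomposition (equivalently, it is the characteristic polynomial of an invertible matrix in $\mathrm{TSR}(m,n;q)$), and uniquely $(m,n)$-decomposable if moreover the pair $(g,h)$ is unique. -}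

module Defs where

open import Level using (0ℓ)
open import Data.Nat as ℕ using (ℕ; zero; suc)
open import Data.Bool using (Bool; true; false; _∧_; _∨_; if_then_else_)
open import Data.Fin as Fin using (Fin; zero; suc; remQuot; toℕ)
open import Data.Fin.Properties using () renaming (_≟_ to _≟F_)
open import Data.Product using (_×_; _,_; proj₁; proj₂; Σ; ∃)
open import Data.List as List using (List; []; _∷_; map; concatMap; filter; length)
open import Data.Bool.ListAction using (any)
open import Data.List.Membership.Propositional using (_∈_)
open import Data.List.Relation.Unary.Unique.Propositional using (Unique)
open import Data.Vec.Functional as VF using (Vector)
open import Relation.Binary.PropositionalEquality using (_≡_)
open import Relation.Binary.Definitions using (DecidableEquality)
open import Relation.Nullary using (¬_; does)
import Algebra.Structures as AS

record FiniteField : Set₁ where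
  field
    Carrier : Set
    _+_ _*_ : Carrier → Carrier → Carrier
    -_      : Carrier → Carrier
    0# 1#   : Carrier
    isCommutativeRing : AS.IsCommutativeRing {A = Carrier} _≡_ _+_ _*_ -_ 0# 1#
    _⁻¹     : Carrier → Carrier
    inverse : ∀ x → ¬ (x ≡ 0#) → (x * (x ⁻¹)) ≡ 1#
    0≢1     : ¬ (0# ≡ 1#)
    _≟_     : DecidableEquality Carrier
    elements : List Carrier
    complete : ∀ x → x ∈ elements
    unique   : Unique elements

  order : ℕ
  order = length elements

allFuns : ∀ {A : Set} → List A → (k : ℕ) → List (Fin k → A)
allFuns xs zero    = (λ ()) ∷ []
allFuns xs (suc k) = concatMap (λ x → map (λ v → x VF.∷ v) (allFuns xs k)) xs

countB : ∀ {A : Set} → (A → Bool) → List A → ℕ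
countB p xs = length (filter (λ x → Data.Bool.T? (p x)) xs)
  where import Data.Bool

allFinB : ∀ {k} → (Fin k → Bool) → Bool
allFinB {zero}  p = true
allFinB {suc k} p = p zero ∧ allFinB (λ i → p (suc i))

module Over (𝔽 : FiniteField) where
  open FiniteField 𝔽

  F : Set
  F = Carrier

  eqB : F → F → Bool
  eqB x y = does (x ≟ y)

  Mat : ℕ → Set
  Mat k = Fin k → Fin k → F

  allMats : (k : ℕ) → List (Mat k)
  allMats k = allFuns (allFuns elements k) k

  matEqB : ∀ {k} → Mat k → Mat k → Bool
  matEqB A B = allFinB (λ i → allFinB (λ j → eqB (A i j) (B i j)))

  -- Polynomials: coefficient lists, lowest degree first; two lists
  -- represent the same polynomial iff they agree up to trailing zeros.

  Poly : Set
  Poly = List F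

  coeff : Poly → ℕ → F
  coeff []       _       = 0#
  coeff (a ∷ p)  zero    = a
  coeff (a ∷ p)  (suc i) = coeff p i

  polyEqB : Poly → Poly → Bool
  polyEqB []       []       = true
  polyEqB []       (b ∷ q)  = eqB b 0# ∧ polyEqB [] q
  polyEqB (a ∷ p)  []       = eqB a 0# ∧ polyEqB p []
  polyEqB (a ∷ p)  (b ∷ q)  = eqB a b ∧ polyEqB p q

  _≈P_ : Poly → Poly → Set
  p ≈P q = polyEqB p q ≡ true

  _+P_ : Poly → Poly → Poly
  []      +P q       = q
  (a ∷ p) +P []      = a ∷ p
  (a ∷ p) +P (b ∷ q) = (a + b) ∷ (p +P q)

  scaleP : F → Poly → Poly
  scaleP c = map (c *_)

  negP : Poly → Poly
  negP = map -_

  _*P_ : Poly → Poly → Poly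
  []      *P q = []
  (a ∷ p) *P q = scaleP a q +P (0# ∷ (p *P q))

  constP : F → Poly
  constP c = c ∷ []

  oneP : Poly
  oneP = constP 1#

  XP : Poly
  XP = 0# ∷ 1# ∷ []

  _^P_ : Poly → ℕ → Poly
  p ^P zero  = oneP
  p ^P suc k = p *P (p ^P k)

  sumP : (k : ℕ) → (ℕ → Poly) → Poly
  sumP zero    f = []
  sumP (suc k) f = sumP k f +P f k

  minor : ∀ {k} → (Fin (suc k) → Fin (suc k) → Poly) → Fin (suc k) →
          Fin k → Fin k → Poly
  minor M j r c = M (suc r) (Fin.punchIn j c)

  detP : ∀ k → (Fin k → Fin k → Poly) → Poly
  detP zero    M = oneP
  detP (suc k) M = go (suc k) (λ j → j) oneP
    where
    go : ∀ r → (Fin r → Fin (suc k)) → Poly → Poly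
    go zero    col s = []
    go (suc r) col s =
      (s *P (M zero (col zero) *P detP k (minor M (col zero))))
        +P go r (λ i → col (suc i)) (negP s)

  charPoly : ∀ {k} → Mat k → Poly
  charPoly {k} T = detP k (λ i j →
    (if does (i ≟F j) then XP else []) +P negP (constP (T i j)))

  -- TSR matrices.  Indices of an (mn)×(mn) matrix are Fin (n * m),
  -- decomposed by remQuot as (block index in Fin n, inner index in Fin m),
  -- i.e. global index = block * m + inner.

  tsr : (m n : ℕ) → (Fin n → F) → Mat m → Mat (n ℕ.* m)
  tsr m n c B r s with remQuot {n} m r | remQuot {n} m s
  ... | (i , a) | (j , b) =
    if ℕ._≡ᵇ_ (suc (toℕ j)) n
    then c i * B a b
    else (if ℕ._≡ᵇ_ (toℕ i) (suc (toℕ j)) ∧ does (a ≟F b) then 1# else 0#)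

  inTSRB : (m n : ℕ) → Mat (n ℕ.* m) → Bool
  inTSRB m n T =
    any (λ c → any (λ B → matEqB T (tsr m n c B)) (allMats m))
        (allFuns elements n)

  countTSR : (m n : ℕ) → Poly → ℕ
  countTSR m n f =
    countB (λ T → inTSRB m n T ∧ polyEqB (charPoly T) f) (allMats (n ℕ.* m))

  Nχ : (m : ℕ) → Poly → ℕ
  Nχ m h = countB (λ A → polyEqB (charPoly A) h) (allMats m)

  -- g(X)^m h(X^n / g(X)) = Σ_{i=0}^{m} h_i X^{n i} g(X)^{m-i}
  decompPoly : (m n : ℕ) → Poly → Poly → Poly
  decompPoly m n g h =
    sumP (suc m) (λ i → scaleP (coeff h i) ((XP ^P (n ℕ.* i)) *P (g ^P (m ℕ.∸ i))))

  IsDecomp : (m n : ℕ) → Poly → Poly → Poly → Set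
  IsDecomp m n f g h =
      (coeff h m ≡ 1#) × (∀ i → m ℕ.< i → coeff h i ≡ 0#) × ¬ (coeff h 0 ≡ 0#)
    × (∀ i → n ℕ.≤ i → coeff g i ≡ 0#) × (coeff g 0 ≡ 1#)
    × (f ≈P decompPoly m n g h)

  IsUniqueDecomp : (m n : ℕ) → Poly → Poly → Poly → Set
  IsUniqueDecomp m n f g h =
    IsDecomp m n f g h ×
    (∀ g' h' → IsDecomp m n f g' h' → (g' ≈P g) × (h' ≈P h))

module Submission where

-- A matrix of TSR(m,n;q) is a block companion matrix T(c,B).  Put c(X) = Σ cᵢ Xⁱ.  Adding
-- X times block row i+1 of X I - T to block row i, from the bottom up, turns the top block
-- row into (0, …, 0, Xⁿ I - c(X) B) and the columns left of the last block into -I below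
-- it, so det(X I - T) = det(Xⁿ I - c(X) B).  This is c(X)ᵐ χ_B(Xⁿ / c(X)), because
-- homogenization is multiplicative and turns the entries of X I - B into those of
-- Xⁿ I - c(X) B.  If det(X I - T) = f, then f(0) ≠ 0 forces c₀ ≠ 0, and rescaling (c,B) to
-- (c/c₀, c₀B) yields a decomposition of f; by uniqueness it is (g,h).  Hence B ↦ T(g,B) is
-- a bijection from the matrices with characteristic polynomial h onto the matrices to be
-- counted.

open import Defs
open import Level using (Level; 0ℓ)
open import Algebra.Bundles using (CommutativeRing; Semiring)
open import Algebra.Structures using (IsCommutativeRing)
open import Data.Bool using (Bool; true; false; if_then_else_; _∧_)
import Data.Bool as Bool
open import Data.Bool.Properties using (T-∧; T-≡)
open import Data.Empty using (⊥; ⊥-elim)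
open import Data.Fin as Fin using (Fin; zero; suc; toℕ; remQuot; combine)
open import Data.Fin.Properties using (toℕ<n; toℕ-injective; toℕ-fromℕ; toℕ-combine; combine-remQuot; remQuot-combine)
  renaming (_≟_ to _≟F_)
open import Data.List as List using (List; []; _∷_; length; filter)
open import Data.List.Membership.Propositional using (find; lose)
open import Data.List.Membership.Propositional.Properties using (∈-filter⁺)
open import Data.List.Properties using (length-removeAt′)
open import Data.List.Relation.Unary.All as All using (All; []; _∷_)
import Data.List.Relation.Unary.All.Properties as All
open import Data.List.Relation.Unary.AllPairs as AllPairs using (AllPairs; []; _∷_)
import Data.List.Relation.Unary.AllPairs.Properties as AllPairs
open import Data.List.Relation.Unary.Any as Any using (Any; here; there; _─_)
import Data.List.Relation.Unary.Any.Properties as Any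
open import Data.Nat as ℕ using (ℕ; zero; suc; _<_; _≤_; z≤n; s≤s; NonZero; _⊔_)
open import Data.Nat.DivMod using (_/_; _%_)
import Data.Nat.DivMod as ℕ
import Data.Nat.Properties as ℕ
open import Data.Product using (_×_; _,_; proj₁; proj₂; ∃; ∃₂)
open import Data.Sum using (_⊎_; inj₁; inj₂)
open import Function using (_∘_; Equivalence)
open import Relation.Binary.PropositionalEquality as ≡ using (_≡_; _≢_; cong; cong₂; subst)
open import Relation.Nullary using (¬_; yes; no; does)

-- The quotient Xⁿ / g(X) is never formed. A polynomial u of degree at most d is replaced by the sum
-- of the uᵢ Yⁱ g^(d-i), which makes sense for all polynomials g and Y. The determinant formula
-- therefore holds before c₀ ≠ 0 is known, and the specialization g = 0 can be used to read off
-- leading coefficients. In the row expansion of det(X I - B) every product has a linear factor, so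
-- multiplicativity is proved only for a linear polynomial times one of bounded degree. Determinants
-- are defined by expansion along the top row. The sweep adds to a row only multiples of lower rows,
-- so the one alternating property required is that a determinant vanishes when its top row recurs
-- below; permutations, transposes and matrix products do not enter. Matrices are functions and can
-- be compared only entry by entry. The bijection is therefore a relation between matrices and
-- blocks, and the two counts are compared by an inequality in each direction.

≡ᵇ-refl : ∀ n → (n ℕ.≡ᵇ n) ≡ true
≡ᵇ-refl n = Equivalence.to T-≡ (ℕ.≡⇒≡ᵇ n n ≡.refl)

-- Quotient and remainder of block indices.

module _ (m : ℕ) .{{_ : NonZero m}} where

  shift-/ : ∀ r → (m ℕ.+ r) / m ≡ suc (r / m)
  shift-/ r = ≡.trans (ℕ.m/n≡1+[m∸n]/n (ℕ.m≤m+n m r)) (cong (λ k → suc (k / m)) (ℕ.m+n∸m≡n m r))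

  shift-% : ∀ r → (m ℕ.+ r) % m ≡ r % m
  shift-% r = ≡.trans (cong (_% m) (ℕ.+-comm m r)) (ℕ.[m+n]%n≡m%n r m)

  block-/ : ∀ i {a} → a < m → (i ℕ.* m ℕ.+ a) / m ≡ i
  block-/ zero    a<m = ℕ.m<n⇒m/n≡0 a<m
  block-/ (suc i) {a} a<m = ≡.trans (cong (_/ m) (ℕ.+-assoc m (i ℕ.* m) a))
    (≡.trans (shift-/ _) (cong suc (block-/ i a<m)))

  block-% : ∀ i {a} → a < m → (i ℕ.* m ℕ.+ a) % m ≡ a
  block-% zero    a<m = ℕ.m<n⇒m%n≡m a<m
  block-% (suc i) {a} a<m = ≡.trans (cong (_% m) (ℕ.+-assoc m (i ℕ.* m) a))
    (≡.trans (shift-% _) (block-% i a<m))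

-- Determinants over a commutative ring.

module Determinant {c ℓ : Level} (R : CommutativeRing c ℓ) where
  open CommutativeRing R hiding (zero)
  open import Relation.Binary.Reasoning.Setoid setoid
  open import Algebra.Properties.Ring ring using (-‿distribˡ-*; -‿distribʳ-*; -0#≈0#; -‿involutive; -‿+-comm)
  open import Algebra.Solver.Ring.NaturalCoefficients.Default commutativeSemiring
    using (solve; _:=_; _:+_; _:*_)
  open import Algebra.Definitions.RawSemiring (Semiring.rawSemiring semiring) using (_^_) public

  opaque
    ∑ : ℕ → (ℕ → Carrier) → Carrier
    ∑ zero    f = 0#
    ∑ (suc n) f = f 0 + ∑ n (f ∘ suc)

    ∑-suc : ∀ n f → ∑ (suc n) f ≈ f 0 + ∑ n (f ∘ suc)
    ∑-suc n f = refl

    ∑-cong : ∀ n {f g} → (∀ {j} → j < n → f j ≈ g j) → ∑ n f ≈ ∑ n g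
    ∑-cong zero    f≈g = refl
    ∑-cong (suc n) f≈g = +-cong (f≈g (s≤s z≤n)) (∑-cong n (f≈g ∘ s≤s))

    ∑-zero : ∀ n {f} → (∀ {j} → j < n → f j ≈ 0#) → ∑ n f ≈ 0#
    ∑-zero zero    f≈0 = refl
    ∑-zero (suc n) f≈0 = trans (+-cong (f≈0 (s≤s z≤n)) (∑-zero n (f≈0 ∘ s≤s))) (+-identityˡ 0#)

    ∑-+ : ∀ n f g → ∑ n (λ j → f j + g j) ≈ ∑ n f + ∑ n g
    ∑-+ zero    f g = sym (+-identityˡ 0#)
    ∑-+ (suc n) f g = trans (+-congˡ (∑-+ n (f ∘ suc) (g ∘ suc)))
      (solve 4 (λ a b s t → (a :+ b) :+ (s :+ t) := (a :+ s) :+ (b :+ t)) refl _ _ _ _)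

    *-distribˡ-∑ : ∀ n a f → a * ∑ n f ≈ ∑ n (λ j → a * f j)
    *-distribˡ-∑ zero    a f = zeroʳ a
    *-distribˡ-∑ (suc n) a f = trans (distribˡ a _ _) (+-congˡ (*-distribˡ-∑ n a (f ∘ suc)))

    ∑-split : ∀ m n f → ∑ (m ℕ.+ n) f ≈ ∑ m f + ∑ n (λ j → f (m ℕ.+ j))
    ∑-split zero    n f = sym (+-identityˡ _)
    ∑-split (suc m) n f = trans (+-congˡ (∑-split m n (f ∘ suc))) (sym (+-assoc _ _ _))

  sign : ℕ → Carrier
  sign zero    = 1#
  sign (suc j) = - sign j

  sign-+ : ∀ i j → sign (i ℕ.+ j) ≈ sign i * sign j
  sign-+ zero    j = sym (*-identityˡ _)
  sign-+ (suc i) j = trans (-‿cong (sign-+ i j)) (-‿distribˡ-* _ _)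

  -x*-y≈x*y : ∀ x y → - x * - y ≈ x * y
  -x*-y≈x*y x y = begin
    - x * - y     ≈⟨ -‿distribˡ-* x (- y) ⟨
    - (x * - y)   ≈⟨ -‿cong (-‿distribʳ-* x y) ⟨
    - - (x * y)   ≈⟨ -‿involutive _ ⟩
    x * y         ∎

  sign²≈1 : ∀ j → sign j * sign j ≈ 1#
  sign²≈1 zero    = *-identityˡ 1#
  sign²≈1 (suc j) = trans (-x*-y≈x*y _ _) (sign²≈1 j)

  sign-square : ∀ m → sign (m ℕ.* m) ≈ sign m
  sign-square zero    = refl
  sign-square (suc m) = -‿cong (begin
    sign (m ℕ.+ m ℕ.* suc m)              ≡⟨ cong (λ x → sign (m ℕ.+ x)) (ℕ.*-suc m m) ⟩
    sign (m ℕ.+ (m ℕ.+ m ℕ.* m))          ≈⟨ sign-+ m _ ⟩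
    sign m * sign (m ℕ.+ m ℕ.* m)         ≈⟨ *-congˡ (trans (sign-+ m _) (*-congˡ (sign-square m))) ⟩
    sign m * (sign m * sign m)            ≈⟨ *-congˡ (sign²≈1 m) ⟩
    sign m * 1#                           ≈⟨ *-identityʳ _ ⟩
    sign m                                ∎)

  -- Because m² and m have the same parity. The left side is the sign of exchanging column blocks of
  -- widths m and n m, the right side is the determinant of -I of size n m.
  sign-block : ∀ m n → sign (m ℕ.* (n ℕ.* m)) ≈ sign (n ℕ.* m)
  sign-block m zero    = reflexive (cong sign (ℕ.*-zeroʳ m))
  sign-block m (suc n) = begin
    sign (m ℕ.* (m ℕ.+ n ℕ.* m))                 ≡⟨ cong sign (ℕ.*-distribˡ-+ m m _) ⟩
    sign (m ℕ.* m ℕ.+ m ℕ.* (n ℕ.* m))           ≈⟨ sign-+ (m ℕ.* m) _ ⟩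
    sign (m ℕ.* m) * sign (m ℕ.* (n ℕ.* m))      ≈⟨ *-cong (sign-square m) (sign-block m n) ⟩
    sign m * sign (n ℕ.* m)                      ≈⟨ sign-+ m _ ⟨
    sign (m ℕ.+ n ℕ.* m)                         ∎

  -- Matrices are indexed by ℕ, so that index arithmetic needs no casts; only the
  -- entries below the size given to det matter.
  Matrix : Set c
  Matrix = ℕ → ℕ → Carrier

  punch : ℕ → ℕ → ℕ
  punch zero    k       = suc k
  punch (suc j) zero    = zero
  punch (suc j) (suc k) = suc (punch j k)

  punch-≤ : ∀ j k → punch j k ≤ suc k
  punch-≤ zero    k       = ℕ.≤-refl
  punch-≤ (suc j) zero    = z≤n
  punch-≤ (suc j) (suc k) = s≤s (punch-≤ j k)

  punch-< : ∀ j {k n} → k < n → punch j k < suc n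
  punch-< j {k} k<n = s≤s (ℕ.≤-trans (punch-≤ j k) k<n)

  punch-below : ∀ j {k} → k < j → punch j k ≡ k
  punch-below (suc j) {zero}  _         = ≡.refl
  punch-below (suc j) {suc k} (s≤s k<j) = cong suc (punch-below j k<j)

  punch-shift : ∀ p j k → punch (p ℕ.+ j) (p ℕ.+ k) ≡ p ℕ.+ punch j k
  punch-shift zero    j k = ≡.refl
  punch-shift (suc p) j k = cong suc (punch-shift p j k)

  minorOf : ℕ → Matrix → Matrix
  minorOf j M r k = M (suc r) (punch j k)

  det : ℕ → Matrix → Carrier
  det zero    M = 1#
  det (suc k) M = ∑ (suc k) (λ j → sign j * (M 0 j * det k (minorOf j M)))

  det-cong : ∀ k {M N} → (∀ {r s} → r < k → s < k → M r s ≈ N r s) → det k M ≈ det k N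
  det-cong zero    M≈N = refl
  det-cong (suc k) M≈N = ∑-cong (suc k) λ {j} j<k → *-congˡ (*-cong (M≈N (s≤s z≤n) j<k)
    (det-cong k λ r<k s<k → M≈N (s≤s r<k) (punch-< j s<k)))

  -- Deleting columns j and then k from a matrix deletes the same two columns as
  -- j' and then k'; Mate relates (j , k) to the other order (j' , k').
  data Mate : ℕ → ℕ → ℕ → ℕ → Set where
    base : ∀ {k} → Mate 0 k (suc k) 0
    step : ∀ {j k j' k'} → Mate j k j' k' → Mate (suc j) (suc k) (suc j') (suc k')

  mate-fst : ∀ {j k j' k'} → Mate j k j' k' → punch j k ≡ j'
  mate-fst base     = ≡.refl
  mate-fst (step m) = cong suc (mate-fst m)

  mate-snd : ∀ {j k j' k'} → Mate j k j' k' → punch j' k' ≡ j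
  mate-snd base     = ≡.refl
  mate-snd (step m) = cong suc (mate-snd m)

  mate-punch : ∀ {j k j' k'} → Mate j k j' k' → ∀ i → punch j (punch k i) ≡ punch j' (punch k' i)
  mate-punch base     i       = ≡.refl
  mate-punch (step m) zero    = ≡.refl
  mate-punch (step m) (suc i) = cong suc (mate-punch m i)

  mate-sign : ∀ {j k j' k'} → Mate j k j' k' → sign j * sign k + sign j' * sign k' ≈ 0#
  mate-sign {k = k} base = trans (+-cong (*-identityˡ _) (*-identityʳ _)) (-‿inverseʳ (sign k))
  mate-sign (step m) = trans (+-cong (-x*-y≈x*y _ _) (-x*-y≈x*y _ _)) (mate-sign m)

  -- Mating is a perfect matching of the index pairs. The pairs with j = 0 are the mates of those
  -- with j > 0 and k = 0; all others have both indices positive and form the same problem one size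
  -- smaller.
  mate-cancel : ∀ n (G : ℕ → ℕ → Carrier) →
    (∀ {j k j' k'} → Mate j k j' k' → G j k + G j' k' ≈ 0#) →
    ∑ (suc n) (λ j → ∑ n (G j)) ≈ 0#
  mate-cancel zero    G cancel = ∑-zero 1 λ _ → ∑-zero 0 λ ()
  mate-cancel (suc n) G cancel = begin
    ∑ (suc (suc n)) (λ j → ∑ (suc n) (G j))
      ≈⟨ ∑-suc (suc n) _ ⟩
    ∑ (suc n) (G 0) + ∑ (suc n) (λ j → ∑ (suc n) (G (suc j)))
      ≈⟨ +-congˡ (trans (∑-cong (suc n) λ _ → ∑-suc n _) (∑-+ (suc n) _ _)) ⟩
    ∑ (suc n) (G 0) + (∑ (suc n) (λ j → G (suc j) 0) + ∑ (suc n) (λ j → ∑ n (λ k → G (suc j) (suc k))))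
      ≈⟨ +-congˡ (+-congˡ (mate-cancel n (λ j k → G (suc j) (suc k)) (cancel ∘ step))) ⟩
    ∑ (suc n) (G 0) + (∑ (suc n) (λ j → G (suc j) 0) + 0#)
      ≈⟨ +-congˡ (+-identityʳ _) ⟩
    ∑ (suc n) (G 0) + ∑ (suc n) (λ j → G (suc j) 0)
      ≈⟨ ∑-+ (suc n) _ _ ⟨
    ∑ (suc n) (λ j → G 0 j + G (suc j) 0)
      ≈⟨ ∑-zero (suc n) (λ _ → cancel base) ⟩
    0# ∎

  module _ (D : ℕ → ℕ → Carrier) (D-mate : ∀ {j k j' k'} → Mate j k j' k' → D j k ≈ D j' k') where

    -- A summand of the expansion along two top rows `u` and `v`, with `D` as the complementary
    -- minor. The rows are arguments so that they can be exchanged or made equal over the same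
    -- minors.
    term : (u v : ℕ → Carrier) → ℕ → ℕ → Carrier
    term u v j k = sign j * (u j * (sign k * (v (punch j k) * D j k)))

    -- Exchanging the rows compensates for the opposite order of the two columns, so both summands
    -- contain the same product of entries and minor; only their signs differ.
    term-cancel : ∀ u v {j k j' k'} → Mate j k j' k' → term u v j k + term v u j' k' ≈ 0#
    term-cancel u v {j} {k} {j'} {k'} m = begin
      term u v j k + term v u j' k'
        ≈⟨ +-cong (*-congˡ (*-congˡ (*-congˡ (*-congʳ (reflexive (cong v (mate-fst m)))))))
                  (*-congˡ (*-congˡ (*-congˡ (*-cong (reflexive (cong u (mate-snd m))) (sym (D-mate m)))))) ⟩
      sign j * (u j * (sign k * (v j' * D j k))) + sign j' * (v j' * (sign k' * (u j * D j k)))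
        ≈⟨ solve 7 (λ a b a' b' x y d → a :* (x :* (b :* (y :* d))) :+ a' :* (y :* (b' :* (x :* d)))
                     := (a :* b :+ a' :* b') :* (x :* (y :* d))) refl
                 (sign j) (sign k) (sign j') (sign k') (u j) (v j') (D j k) ⟩
      (sign j * sign k + sign j' * sign k') * (u j * (v j' * D j k))
        ≈⟨ *-congʳ (mate-sign m) ⟩
      0# * (u j * (v j' * D j k))
        ≈⟨ zeroˡ _ ⟩
      0# ∎

  minor₂ : ℕ → ℕ → ℕ → Matrix → Carrier
  minor₂ n j k M = det n (minorOf k (minorOf j M))

  minor₂-mate : ∀ n M {j k j' k'} → Mate j k j' k' → minor₂ n j k M ≈ minor₂ n j' k' M
  minor₂-mate n M m = det-cong n λ {r} {s} _ _ → reflexive (cong (M (suc (suc r))) (mate-punch m s))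

  det-expand₂ : ∀ n M → det (suc (suc n)) M ≈
    ∑ (suc (suc n)) (λ j → ∑ (suc n) (term (λ j k → minor₂ n j k M) (minor₂-mate n M) (M 0) (M 1) j))
  det-expand₂ n M = ∑-cong (suc (suc n)) λ {j} _ →
    trans (*-congˡ (*-distribˡ-∑ (suc n) (M 0 j) _)) (*-distribˡ-∑ (suc n) (sign j) _)

  -- Obtained by cancelling summands in pairs. Antisymmetry would give only 2 det = 0, which says
  -- nothing in characteristic 2.
  det-repeat₀₁ : ∀ n M → (∀ s → M 0 s ≈ M 1 s) → det (suc (suc n)) M ≈ 0#
  det-repeat₀₁ n M M₀≈M₁ = begin
    det (suc (suc n)) M
      ≈⟨ det-expand₂ n M ⟩
    ∑ (suc (suc n)) (λ j → ∑ (suc n) (T (M 0) (M 1) j))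
      ≈⟨ ∑-cong (suc (suc n)) (λ {j} _ → ∑-cong (suc n) λ _ → *-congˡ (*-congʳ (M₀≈M₁ j))) ⟩
    ∑ (suc (suc n)) (λ j → ∑ (suc n) (T (M 1) (M 1) j))
      ≈⟨ mate-cancel (suc n) (T (M 1) (M 1)) (term-cancel _ (minor₂-mate n M) (M 1) (M 1)) ⟩
    0# ∎
    where T = term (λ j k → minor₂ n j k M) (minor₂-mate n M)

  swapAdj : ∀ {a} {A : Set a} → ℕ → (ℕ → A) → ℕ → A
  swapAdj zero    f zero          = f 1
  swapAdj zero    f (suc zero)    = f 0
  swapAdj zero    f (suc (suc r)) = f (suc (suc r))
  swapAdj (suc i) f zero          = f 0
  swapAdj (suc i) f (suc r)       = swapAdj i (f ∘ suc) r

  -- Deleting a column and reading an entry are maps applied to each row, so a swap below the top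
  -- row passes to the minors.
  swapAdj-natural : ∀ {a b} {A : Set a} {B : Set b} i (h : A → B) f r →
    h (swapAdj i f r) ≡ swapAdj i (h ∘ f) r
  swapAdj-natural zero    h f zero          = ≡.refl
  swapAdj-natural zero    h f (suc zero)    = ≡.refl
  swapAdj-natural zero    h f (suc (suc r)) = ≡.refl
  swapAdj-natural (suc i) h f zero          = ≡.refl
  swapAdj-natural (suc i) h f (suc r)       = swapAdj-natural i h (f ∘ suc) r

  swapAdj-at : ∀ {a} {A : Set a} i (f : ℕ → A) → swapAdj i f i ≡ f (suc i)
  swapAdj-at zero    f = ≡.refl
  swapAdj-at (suc i) f = swapAdj-at i (f ∘ suc)

  -- Antisymmetry in the additive form that `mate-cancel` delivers. A swap of the top two rows
  -- exchanges `u` and `v` in every `term`; a swap further down is inherited from the minors.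
  det-swapAdj : ∀ n i M → suc i < n → det n M + det n (swapAdj i M) ≈ 0#
  det-swapAdj (suc zero)    i    M (s≤s ())
  det-swapAdj (suc (suc n)) zero M _ = begin
    det (suc (suc n)) M + det (suc (suc n)) (swapAdj 0 M)
      ≈⟨ +-cong (det-expand₂ n M) (det-expand₂ n (swapAdj 0 M)) ⟩
    ∑ (suc (suc n)) (λ j → ∑ (suc n) (T (M 0) (M 1) j)) + ∑ (suc (suc n)) (λ j → ∑ (suc n) (T (M 1) (M 0) j))
      ≈⟨ trans (∑-cong (suc (suc n)) λ _ → ∑-+ (suc n) _ _) (∑-+ (suc (suc n)) _ _) ⟨
    ∑ (suc (suc n)) (λ j → ∑ (suc n) (λ k → T (M 0) (M 1) j k + T (M 1) (M 0) j k))
      ≈⟨ mate-cancel (suc n) _ (λ {j} {k} {j'} {k'} m → begin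
           (T (M 0) (M 1) j k + T (M 1) (M 0) j k) + (T (M 0) (M 1) j' k' + T (M 1) (M 0) j' k')
             -- Each summand of one determinant is grouped with the mated summand of the other,
             -- where the rows are interchanged.
             ≈⟨ solve 4 (λ a b c d → (a :+ b) :+ (c :+ d) := (a :+ d) :+ (b :+ c)) refl _ _ _ _ ⟩
           (T (M 0) (M 1) j k + T (M 1) (M 0) j' k') + (T (M 1) (M 0) j k + T (M 0) (M 1) j' k')
             ≈⟨ +-cong (term-cancel _ (minor₂-mate n M) (M 0) (M 1) m)
                       (term-cancel _ (minor₂-mate n M) (M 1) (M 0) m) ⟩
           0# + 0# ≈⟨ +-identityˡ 0# ⟩
           0# ∎) ⟩
    0# ∎
    where T = term (λ j k → minor₂ n j k M) (minor₂-mate n M)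
  det-swapAdj (suc n) (suc i) M (s≤s i<n) = begin
    det (suc n) M + det (suc n) (swapAdj (suc i) M)
      ≈⟨ ∑-+ (suc n) _ _ ⟨
    ∑ (suc n) (λ j → sign j * (M 0 j * det n (minorOf j M)) +
                     sign j * (M 0 j * det n (minorOf j (swapAdj (suc i) M))))
      ≈⟨ ∑-zero (suc n) (λ {j} _ → begin
           sign j * (M 0 j * det n (minorOf j M)) + sign j * (M 0 j * det n (minorOf j (swapAdj (suc i) M)))
             ≈⟨ +-congˡ (*-congˡ (*-congˡ (det-cong n λ {r} {s} _ _ →
                  reflexive (≡.trans (swapAdj-natural i (λ v → v (punch j s)) (M ∘ suc) r)
                                     (≡.sym (swapAdj-natural i (λ v → v s) (minorOf j M) r)))))) ⟩
           sign j * (M 0 j * det n (minorOf j M)) + sign j * (M 0 j * det n (swapAdj i (minorOf j M)))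
             ≈⟨ solve 4 (λ a b x y → a :* (b :* x) :+ a :* (b :* y) := a :* (b :* (x :+ y))) refl _ _ _ _ ⟩
           sign j * (M 0 j * (det n (minorOf j M) + det n (swapAdj i (minorOf j M))))
             ≈⟨ *-congˡ (*-congˡ (det-swapAdj n i (minorOf j M) i<n)) ⟩
           sign j * (M 0 j * 0#)
             ≈⟨ trans (*-congˡ (zeroʳ _)) (zeroʳ _) ⟩
           0# ∎) ⟩
    0# ∎

  -- Adjacent swaps carry the repeated row up until it lies directly under the top row. They leave
  -- the top row alone and only change the sign of the determinant.
  det-repeat : ∀ n k M → suc k < n → (∀ s → M 0 s ≈ M (suc k) s) → det n M ≈ 0#
  det-repeat (suc zero)    k       M (s≤s ())
  det-repeat (suc (suc n)) zero    M _   M₀≈M₁ = det-repeat₀₁ n M M₀≈M₁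
  det-repeat (suc (suc n)) (suc k) M k<n M₀≈Mₖ = begin
    det (suc (suc n)) M
      ≈⟨ +-identityʳ _ ⟨
    det (suc (suc n)) M + 0#
      ≈⟨ +-congˡ (det-repeat (suc (suc n)) k (swapAdj (suc k) M) (ℕ.<-trans (ℕ.n<1+n _) k<n)
           λ s → trans (M₀≈Mₖ s) (reflexive (cong (λ v → v s) (≡.sym (swapAdj-at k (M ∘ suc)))))) ⟨
    det (suc (suc n)) M + det (suc (suc n)) (swapAdj (suc k) M)
      ≈⟨ det-swapAdj (suc (suc n)) (suc k) M k<n ⟩
    0# ∎

  -- The added row is taken from the new matrix `N`, not from `M`, so that a whole sweep from the
  -- bottom up is a single condition on all rows. The requirement r < s also makes the condition
  -- pass to minors, since the added row is never the deleted top row.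
  RowOp : ℕ → Matrix → Matrix → ℕ → Set (c Level.⊔ ℓ)
  RowOp n M N r = (∀ {k} → k < n → N r k ≈ M r k) ⊎
    ∃₂ λ s a → r < s × s < n × (∀ {k} → k < n → N r k ≈ M r k + a * N s k)

  minor-rowOp : ∀ {n M N r} j → RowOp (suc n) M N (suc r) → RowOp n (minorOf j M) (minorOf j N) r
  minor-rowOp j (inj₁ eq) = inj₁ (eq ∘ punch-< j)
  minor-rowOp j (inj₂ (suc s , a , s≤s r<s , s≤s s<n , eq)) = inj₂ (s , a , r<s , s<n , eq ∘ punch-< j)

  replaceTop : (ℕ → Carrier) → Matrix → Matrix
  replaceTop v M zero    = v
  replaceTop v M (suc r) = M (suc r)

  -- By linearity in the top row, the added multiple contributes a determinant whose top row recurs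
  -- below, which is zero. What remains has the top row of `M`, and its minors are handled by
  -- induction.
  det-rowOps : ∀ n M N → (∀ {r} → r < n → RowOp n M N r) → det n N ≈ det n M
  det-rowOps zero    M N op = refl
  det-rowOps (suc n) M N op with op (s≤s z≤n)
  ... | inj₁ N₀≈M₀ = ∑-cong (suc n) λ {j} j<n →
    *-congˡ (*-cong (N₀≈M₀ j<n) (det-rowOps n _ _ λ r<n → minor-rowOp {M = M} {N} j (op (s≤s r<n))))
  ... | inj₂ (suc s , a , _ , s<n , N₀≈) = begin
    ∑ (suc n) (λ j → sign j * (N 0 j * D j))
      ≈⟨ ∑-cong (suc n) (λ {j} j<n → trans (*-congˡ (*-congʳ (N₀≈ j<n)))
           (solve 5 (λ σ m a v d → σ :* ((m :+ a :* v) :* d) := σ :* (m :* d) :+ a :* (σ :* (v :* d))) refl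
             (sign j) (M 0 j) a (N (suc s) j) (D j))) ⟩
    ∑ (suc n) (λ j → sign j * (M 0 j * D j) + a * (sign j * (N (suc s) j * D j)))
      ≈⟨ ∑-+ (suc n) _ _ ⟩
    ∑ (suc n) (λ j → sign j * (M 0 j * D j)) + ∑ (suc n) (λ j → a * (sign j * (N (suc s) j * D j)))
      ≈⟨ +-cong (∑-cong (suc n) λ {j} _ → *-congˡ (*-congˡ
                  (det-rowOps n _ _ λ r<n → minor-rowOp {M = M} {N} j (op (s≤s r<n)))))
                (sym (*-distribˡ-∑ (suc n) a _)) ⟩
    det (suc n) M + a * det (suc n) (replaceTop (N (suc s)) N)
      ≈⟨ +-congˡ (*-congˡ (det-repeat (suc n) s (replaceTop (N (suc s)) N) s<n λ _ → refl)) ⟩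
    det (suc n) M + a * 0#
      ≈⟨ trans (+-congˡ (zeroʳ a)) (+-identityʳ _) ⟩
    det (suc n) M ∎
    where
    D : ℕ → Carrier
    D j = det n (minorOf j N)

  δ : ℕ → ℕ → Carrier
  δ r s = if r ℕ.≡ᵇ s then 1# else 0#

  δ-≢ : ∀ {r s} → r ≢ s → δ r s ≈ 0#
  δ-≢ {r} {s} r≢s with r ℕ.≡ᵇ s in eq
  ... | false = refl
  ... | true  = ⊥-elim (r≢s (ℕ.≡ᵇ⇒≡ r s (subst Bool.T (≡.sym eq) _)))

  δ-shift : ∀ m r s → δ (m ℕ.+ r) (m ℕ.+ s) ≡ δ r s
  δ-shift zero    r s = ≡.refl
  δ-shift (suc m) r s = δ-shift m r s

  det-scalar : ∀ n a → det n (λ r s → a * δ r s) ≈ a ^ n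
  det-scalar zero    a = refl
  det-scalar (suc n) a = begin
    det (suc n) (λ r s → a * δ r s)
      ≈⟨ ∑-suc n _ ⟩
    1# * (a * 1# * det n (λ r s → a * δ r s)) + ∑ n (λ j → - sign j * (a * 0# * det n (minorOf (suc j) (λ r s → a * δ r s))))
      ≈⟨ +-cong (trans (*-identityˡ _) (*-cong (*-identityʳ a) (det-scalar n a)))
                (∑-zero n λ _ → trans (*-congˡ (trans (*-congʳ (zeroʳ a)) (zeroˡ _))) (zeroʳ _)) ⟩
    a * a ^ n + 0#
      ≈⟨ +-identityʳ _ ⟩
    a ^ suc n ∎

  sign≈-1^ : ∀ n → (- 1#) ^ n ≈ sign n
  sign≈-1^ zero    = refl
  sign≈-1^ (suc n) = trans (sym (-‿distribˡ-* _ _)) (-‿cong (trans (*-identityˡ _) (sign≈-1^ n)))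

  -- Expansion along the top row: the first p summands vanish, and deleting one of the later columns
  -- keeps the zero block, now with m - 1 rows. The sign is that of moving the last m columns past
  -- the first p.
  det-block : ∀ m p N → (∀ {r s} → r < m → s < p → N r s ≈ 0#) →
    det (m ℕ.+ p) N ≈
    sign (m ℕ.* p) * (det m (λ r s → N r (p ℕ.+ s)) * det p (λ r s → N (m ℕ.+ r) s))
  det-block zero    p N N≈0 = sym (trans (*-identityˡ _) (*-identityˡ _))
  det-block (suc m) p N N≈0 = begin
    ∑ (suc (m ℕ.+ p)) T
      ≡⟨ cong (λ k → ∑ k T) (≡.trans (cong suc (ℕ.+-comm m p)) (≡.sym (ℕ.+-suc p m))) ⟩
    ∑ (p ℕ.+ suc m) T
      ≈⟨ ∑-split p (suc m) T ⟩
    ∑ p T + ∑ (suc m) (λ j → T (p ℕ.+ j))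
      ≈⟨ +-cong (∑-zero p λ j<p → trans (*-congˡ (trans (*-congʳ (N≈0 (s≤s z≤n) j<p)) (zeroˡ _))) (zeroʳ _))
                (∑-cong (suc m) λ {j} _ → T-right j) ⟩
    0# + ∑ (suc m) (λ j → (sign (p ℕ.+ m ℕ.* p) * D) * U j)
      ≈⟨ trans (+-identityˡ _) (sym (*-distribˡ-∑ (suc m) _ U)) ⟩
    (sign (p ℕ.+ m ℕ.* p) * D) * ∑ (suc m) U
      ≈⟨ solve 3 (λ σ d u → (σ :* d) :* u := σ :* (u :* d)) refl _ _ _ ⟩
    sign (p ℕ.+ m ℕ.* p) * (∑ (suc m) U * D) ∎
    where
    N' : Matrix
    N' r s = N r (p ℕ.+ s)
    D : Carrier
    D = det p (λ r s → N (suc m ℕ.+ r) s)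
    T U : ℕ → Carrier
    T j = sign j * (N 0 j * det (m ℕ.+ p) (minorOf j N))
    U j = sign j * (N' 0 j * det m (minorOf j N'))
    T-right : ∀ j → T (p ℕ.+ j) ≈ (sign (p ℕ.+ m ℕ.* p) * D) * U j
    T-right j = begin
      sign (p ℕ.+ j) * (N' 0 j * det (m ℕ.+ p) (minorOf (p ℕ.+ j) N))
        ≈⟨ *-cong (sign-+ p j) (*-congˡ (det-block m p (minorOf (p ℕ.+ j) N) λ {r} {s} r<m s<p →
             trans (reflexive (cong (N (suc r)) (punch-below (p ℕ.+ j) (ℕ.<-≤-trans s<p (ℕ.m≤m+n p j)))))
                   (N≈0 (s≤s r<m) s<p))) ⟩
      (sign p * sign j) * (N' 0 j * (sign (m ℕ.* p) *
        (det m (λ r s → N (suc r) (punch (p ℕ.+ j) (p ℕ.+ s))) *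
         det p (λ r s → N (suc (m ℕ.+ r)) (punch (p ℕ.+ j) s)))))
        ≈⟨ *-congˡ (*-congˡ (*-congˡ (*-cong
             (det-cong m λ {r} {s} _ _ → reflexive (cong (N (suc r)) (punch-shift p j s)))
             (det-cong p λ {r} {s} _ s<p → reflexive
               (cong (N (suc (m ℕ.+ r))) (punch-below (p ℕ.+ j) (ℕ.<-≤-trans s<p (ℕ.m≤m+n p j)))))))) ⟩
      (sign p * sign j) * (N' 0 j * (sign (m ℕ.* p) * (det m (minorOf j N') * D)))
        ≈⟨ solve 6 (λ σ τ a ρ x d → (σ :* τ) :* (a :* (ρ :* (x :* d))) := ((σ :* ρ) :* d) :* (τ :* (a :* x)))
             refl (sign p) (sign j) (N' 0 j) (sign (m ℕ.* p)) (det m (minorOf j N')) D ⟩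
      ((sign p * sign (m ℕ.* p)) * D) * U j
        ≈⟨ *-congʳ (*-congʳ (sign-+ p (m ℕ.* p))) ⟨
      (sign (p ℕ.+ m ℕ.* p) * D) * U j ∎

  -- The characteristic matrix of a block companion matrix.

  juxtapose : ∀ {a} {A : Set a} → ℕ → (ℕ → A) → (ℕ → A) → ℕ → A
  juxtapose zero    f g s       = g s
  juxtapose (suc p) f g zero    = f 0
  juxtapose (suc p) f g (suc s) = juxtapose p (f ∘ suc) g s

  juxtapose-< : ∀ {a} {A : Set a} {p} {f g : ℕ → A} {s} → s < p → juxtapose p f g s ≡ f s
  juxtapose-< {p = suc p} {s = zero}  _         = ≡.refl
  juxtapose-< {p = suc p} {s = suc s} (s≤s s<p) = juxtapose-< s<p

  juxtapose-+ : ∀ {a} {A : Set a} p {f g : ℕ → A} s → juxtapose p f g (p ℕ.+ s) ≡ g s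
  juxtapose-+ zero    s = ≡.refl
  juxtapose-+ (suc p) s = juxtapose-+ p s

  -- The block companion matrix has size n m, with n = suc n', and p = n' m is the
  -- number of columns to the left of its last block column.
  module BlockCompanion (m n' : ℕ) .{{_ : NonZero m}} (c : ℕ → Carrier) (B : Matrix) where

    n p : ℕ
    n = suc n'
    p = n' ℕ.* m

    companion : Matrix
    companion r = juxtapose p (λ s → δ r (m ℕ.+ s)) (λ b → c (r / m) * B (r % m) b)

    -- The hypotheses describe Horner's scheme: `g i` is c_i + x c_(i+1) + ... up to c_(n-1), so
    -- that `g 0` is c(x).
    module _ (x : Carrier) (g : ℕ → Carrier)
             (g-step : ∀ {i} → i < n → g i ≈ c i + x * g (suc i)) (gₙ≈0 : g n ≈ 0#) where

      -- `reduced` is the outcome of the sweep in closed form. Its block row i collects x^(k-i)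
      -- times block row k of the characteristic matrix over all k ≥ i; the power of x in the last
      -- block column comes from the diagonal x I of the last block row.
      charMatrix reduced : Matrix
      charMatrix r s = x * δ r s + - companion r s
      reduced r = juxtapose p (λ s → - δ r (m ℕ.+ s))
        (λ b → x ^ (n ℕ.∸ r / m) * δ (r % m) b + - (g (r / m) * B (r % m) b))

      left-reduced : ∀ {r s} → s < p → reduced r s ≈ - δ r (m ℕ.+ s)
      left-reduced s<p = reflexive (juxtapose-< s<p)

      right-reduced : ∀ r {i a} b → r / m ≡ i → r % m ≡ a →
        reduced r (p ℕ.+ b) ≈ x ^ (n ℕ.∸ i) * δ a b + - (g i * B a b)
      right-reduced r b ≡.refl ≡.refl = reflexive (juxtapose-+ p b)

      left-charMatrix : ∀ {r s} → s < p → charMatrix r s ≈ x * δ r s + - δ r (m ℕ.+ s)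
      left-charMatrix s<p = +-congˡ (-‿cong (reflexive (juxtapose-< s<p)))

      right-charMatrix : ∀ r {i a} b → r / m ≡ i → r % m ≡ a →
        charMatrix r (p ℕ.+ b) ≈ x * δ r (p ℕ.+ b) + - (c i * B a b)
      right-charMatrix r b ≡.refl ≡.refl = +-congˡ (-‿cong (reflexive (juxtapose-+ p b)))

      -- Serves for rows as well as columns, because the last block row and the last block column
      -- both begin at index `p`.
      data Side : ℕ → Set where
        left  : ∀ {s} → s < p → Side s
        right : ∀ {b} → b < m → Side (p ℕ.+ b)

      side : ∀ {s} → s < m ℕ.+ p → Side s
      side {s} s<k with s ℕ.<? p
      ... | yes s<p = left s<p
      ... | no  s≮p = subst Side (ℕ.m+[n∸m]≡n p≤s)
        (right (ℕ.+-cancelˡ-< p _ _ (subst (_< p ℕ.+ m) (≡.sym (ℕ.m+[n∸m]≡n p≤s)) (subst (s <_) (ℕ.+-comm m p) s<k))))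
        where p≤s = ℕ.≮⇒≥ s≮p

      upper-rowOp : ∀ {r s} → r < p → Side s → reduced r s ≈ charMatrix r s + x * reduced (m ℕ.+ r) s
      upper-rowOp {r} {s} r<p (left s<p) = begin
        reduced r s
          ≈⟨ left-reduced s<p ⟩
        - δ r (m ℕ.+ s)
          ≈⟨ +-identityʳ _ ⟨
        - δ r (m ℕ.+ s) + 0#
          -- The diagonal entry x is cancelled by x times the entry -1 that lies one block row
          -- further down.
          ≈⟨ +-congˡ (trans (+-congˡ (sym (-‿distribʳ-* _ _))) (-‿inverseʳ (x * δ r s))) ⟨
        - δ r (m ℕ.+ s) + (x * δ r s + x * - δ r s)
          ≈⟨ solve 3 (λ a b c → a :+ (b :+ c) := (b :+ a) :+ c) refl _ _ _ ⟩
        (x * δ r s + - δ r (m ℕ.+ s)) + x * - δ r s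
          ≈⟨ +-cong (left-charMatrix s<p)
                    (*-congˡ (trans (left-reduced s<p) (-‿cong (reflexive (δ-shift m r s))))) ⟨
        charMatrix r s + x * reduced (m ℕ.+ r) s ∎
      upper-rowOp {r} r<p (right {b} b<m) = begin
        reduced r (p ℕ.+ b)
          ≈⟨ right-reduced r b ≡.refl ≡.refl ⟩
        x ^ (n ℕ.∸ i) * d + - (g i * β)
          ≈⟨ +-cong (*-congʳ (reflexive (cong (x ^_) (ℕ.+-∸-assoc 1 (ℕ.<⇒≤ i<n')))))
                    (-‿cong (trans (*-congʳ (g-step (ℕ.m<n⇒m<1+n i<n'))) (distribʳ β _ _))) ⟩
        (x * x ^ (n' ℕ.∸ i)) * d + - (c i * β + (x * g (suc i)) * β)
          ≈⟨ +-congˡ (-‿+-comm _ _) ⟨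
        (x * x ^ (n' ℕ.∸ i)) * d + (- (c i * β) + - ((x * g (suc i)) * β))
          ≈⟨ +-congˡ (+-congˡ (trans (-‿cong (*-assoc _ _ _)) (-‿distribʳ-* _ _))) ⟩
        (x * x ^ (n' ℕ.∸ i)) * d + (- (c i * β) + x * - (g (suc i) * β))
          ≈⟨ solve 5 (λ x y d c g → (x :* y) :* d :+ (c :+ x :* g) := c :+ x :* (y :* d :+ g)) refl _ _ _ _ _ ⟩
        - (c i * β) + x * (x ^ (n' ℕ.∸ i) * d + - (g (suc i) * β))
          -- Above the last block row the diagonal does not meet the last block column, so x enters
          -- only through the row below.
          ≈⟨ +-cong (trans (+-congʳ (trans (*-congˡ (δ-≢ (ℕ.<⇒≢ (ℕ.<-≤-trans r<p (ℕ.m≤m+n p b))))) (zeroʳ x)))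
                           (+-identityˡ _)) refl ⟨
        (x * δ r (p ℕ.+ b) + - (c i * β)) + x * (x ^ (n' ℕ.∸ i) * d + - (g (suc i) * β))
          ≈⟨ +-cong (right-charMatrix r b ≡.refl ≡.refl) (*-congˡ (right-reduced (m ℕ.+ r) b (shift-/ m r) (shift-% m r))) ⟨
        charMatrix r (p ℕ.+ b) + x * reduced (m ℕ.+ r) (p ℕ.+ b) ∎
        where
        i = r / m
        β = B (r % m) b
        d = δ (r % m) b
        i<n' : i < n'
        i<n' = ℕ.m<n*o⇒m/o<n r<p

      -- The sweep starts from the last block row and leaves it as it is: there the power of x is x
      -- itself, and `g n'` is `c n'` because `g n` vanishes.
      lower-rowOp : ∀ {a s} → a < m → Side s → reduced (p ℕ.+ a) s ≈ charMatrix (p ℕ.+ a) s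
      lower-rowOp {a} {s} a<m (left s<p) = begin
        reduced (p ℕ.+ a) s
          ≈⟨ left-reduced s<p ⟩
        - δ (p ℕ.+ a) (m ℕ.+ s)
          ≈⟨ +-identityˡ _ ⟨
        0# + - δ (p ℕ.+ a) (m ℕ.+ s)
          ≈⟨ +-congʳ (trans (*-congˡ (δ-≢ (≡.≢-sym (ℕ.<⇒≢ (ℕ.<-≤-trans s<p (ℕ.m≤m+n p a)))))) (zeroʳ x)) ⟨
        x * δ (p ℕ.+ a) s + - δ (p ℕ.+ a) (m ℕ.+ s)
          ≈⟨ left-charMatrix s<p ⟨
        charMatrix (p ℕ.+ a) s ∎
      lower-rowOp {a} a<m (right {b} b<m) = begin
        reduced (p ℕ.+ a) (p ℕ.+ b)
          ≈⟨ right-reduced (p ℕ.+ a) b (block-/ m n' a<m) (block-% m n' a<m) ⟩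
        x ^ (n ℕ.∸ n') * δ a b + - (g n' * B a b)
          ≈⟨ +-cong (*-cong (trans (reflexive (cong (x ^_) (ℕ.m+n∸n≡m 1 n'))) (*-identityʳ x))
                            (reflexive (≡.sym (δ-shift p a b))))
                    (-‿cong (*-congʳ (trans (g-step ℕ.≤-refl)
                      (trans (+-congˡ (trans (*-congˡ gₙ≈0) (zeroʳ x))) (+-identityʳ _))))) ⟩
        x * δ (p ℕ.+ a) (p ℕ.+ b) + - (c n' * B a b)
          ≈⟨ right-charMatrix (p ℕ.+ a) b (block-/ m n' a<m) (block-% m n' a<m) ⟨
        charMatrix (p ℕ.+ a) (p ℕ.+ b) ∎

      rowOp : ∀ {r} → Side r → RowOp (m ℕ.+ p) charMatrix reduced r
      rowOp (left {r} r<p) = inj₂ (m ℕ.+ r , x , ℕ.m<n+m r (ℕ.>-nonZero⁻¹ m) , ℕ.+-monoʳ-< m r<p ,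
        λ s<k → upper-rowOp r<p (side s<k))
      rowOp (right a<m) = inj₁ λ s<k → lower-rowOp a<m (side s<k)

      det-charMatrix : det (m ℕ.+ p) charMatrix ≈ det m (λ a b → x ^ n * δ a b + - (g 0 * B a b))
      det-charMatrix = begin
        det (m ℕ.+ p) charMatrix
          ≈⟨ det-rowOps (m ℕ.+ p) charMatrix reduced (λ r<k → rowOp (side r<k)) ⟨
        det (m ℕ.+ p) reduced
          ≈⟨ det-block m p reduced (λ r<m s<p → trans (left-reduced s<p)
               (trans (-‿cong (δ-≢ (ℕ.<⇒≢ (ℕ.<-≤-trans r<m (ℕ.m≤m+n m _))))) -0#≈0#)) ⟩
        sign (m ℕ.* p) * (det m (λ a b → reduced a (p ℕ.+ b)) * det p (λ r s → reduced (m ℕ.+ r) s))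
          ≈⟨ *-cong (sign-block m n') (*-cong
               (det-cong m λ {a} {b} a<m _ → right-reduced a b (ℕ.m<n⇒m/n≡0 a<m) (ℕ.m<n⇒m%n≡m a<m))
               (trans (det-cong p λ {r} {s} _ s<p → trans (left-reduced s<p)
                        (trans (-‿cong (trans (reflexive (δ-shift m r s)) (sym (*-identityˡ _)))) (-‿distribˡ-* _ _)))
                      (trans (det-scalar p (- 1#)) (sign≈-1^ p)))) ⟩
        sign p * (D * sign p)
          -- One sign comes from exchanging the column blocks, the other is det(-I) of size `p`.
          ≈⟨ solve 2 (λ σ d → σ :* (d :* σ) := (σ :* σ) :* d) refl _ _ ⟩
        (sign p * sign p) * D
          ≈⟨ trans (*-congʳ (sign²≈1 p)) (*-identityˡ D) ⟩
        D ∎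
        where
        D = det m (λ a b → x ^ n * δ a b + - (g 0 * B a b))

-- Coefficient lists as a commutative ring.

module PolynomialRing (𝔽 : FiniteField) where
  open Over 𝔽

  fieldRing : CommutativeRing 0ℓ 0ℓ
  fieldRing = record { isCommutativeRing = FiniteField.isCommutativeRing 𝔽 }

  private
    module 𝕂 = CommutativeRing fieldRing
  open CommutativeRing fieldRing using (_+_; _*_; -_; 0#)
  open import Algebra.Solver.Ring.NaturalCoefficients.Default 𝕂.commutativeSemiring
    using (solve; _:=_; _:+_; _:*_)
  open import Algebra.Properties.Ring 𝕂.ring using (-0#≈0#)

  infix 4 _≋_
  -- A record rather than a bare family of equations, so that both polynomials can be inferred from
  -- the type of a proof.
  record _≋_ (p q : Poly) : Set where
    constructor mk≋
    field coeff≡ : ∀ i → coeff p i ≡ coeff q i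
  open _≋_ public

  coeff-+P : ∀ p q i → coeff (p +P q) i ≡ coeff p i + coeff q i
  coeff-+P []      q       i       = ≡.sym (𝕂.+-identityˡ _)
  coeff-+P (a ∷ p) []      i       = ≡.sym (𝕂.+-identityʳ _)
  coeff-+P (a ∷ p) (b ∷ q) zero    = ≡.refl
  coeff-+P (a ∷ p) (b ∷ q) (suc i) = coeff-+P p q i

  coeff-negP : ∀ p i → coeff (negP p) i ≡ - coeff p i
  coeff-negP []      i       = ≡.sym -0#≈0#
  coeff-negP (a ∷ p) zero    = ≡.refl
  coeff-negP (a ∷ p) (suc i) = coeff-negP p i

  coeff-scale : ∀ a p i → coeff (scaleP a p) i ≡ a * coeff p i
  coeff-scale a []      i       = ≡.sym (𝕂.zeroʳ a)
  coeff-scale a (b ∷ p) zero    = ≡.refl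
  coeff-scale a (b ∷ p) (suc i) = coeff-scale a p i

  -- List products are compared through their coefficients, so that trailing zeros play
  -- no role.
  conv : (ℕ → F) → (ℕ → F) → ℕ → F
  conv u v zero    = u 0 * v 0
  conv u v (suc i) = u 0 * v (suc i) + conv (u ∘ suc) v i

  conv-cong : ∀ {u u' v v'} → (∀ i → u i ≡ u' i) → (∀ i → v i ≡ v' i) → ∀ i → conv u v i ≡ conv u' v' i
  conv-cong eu ev zero    = cong₂ _*_ (eu 0) (ev 0)
  conv-cong eu ev (suc i) = cong₂ _+_ (cong₂ _*_ (eu 0) (ev (suc i))) (conv-cong (eu ∘ suc) ev i)

  conv-zeroˡ : ∀ v i → conv (λ _ → 0#) v i ≡ 0#
  conv-zeroˡ v zero    = 𝕂.zeroˡ _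
  conv-zeroˡ v (suc i) = ≡.trans (cong₂ _+_ (𝕂.zeroˡ _) (conv-zeroˡ v i)) (𝕂.+-identityˡ 0#)

  conv-+ˡ : ∀ u v w i → conv (λ j → u j + v j) w i ≡ conv u w i + conv v w i
  conv-+ˡ u v w zero    = 𝕂.distribʳ _ _ _
  conv-+ˡ u v w (suc i) = ≡.trans (𝕂.+-congˡ (conv-+ˡ (u ∘ suc) (v ∘ suc) w i))
    (solve 5 (λ a b c x y → (a :+ b) :* c :+ (x :+ y) := (a :* c :+ x) :+ (b :* c :+ y)) ≡.refl (u 0) (v 0) (w (suc i)) _ _)

  conv-scaleˡ : ∀ a u v i → conv (λ j → a * u j) v i ≡ a * conv u v i
  conv-scaleˡ a u v zero    = 𝕂.*-assoc _ _ _
  conv-scaleˡ a u v (suc i) = ≡.trans (𝕂.+-congˡ (conv-scaleˡ a (u ∘ suc) v i))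
    (solve 4 (λ a b c x → (a :* b) :* c :+ a :* x := a :* (b :* c :+ x)) ≡.refl a (u 0) (v (suc i)) _)

  -- `conv` recurses on its first argument; commutativity requires the same recursion on the second.
  conv-sucʳ : ∀ u v i → conv u v (suc i) ≡ u (suc i) * v 0 + conv u (v ∘ suc) i
  conv-sucʳ u v zero    = 𝕂.+-comm _ _
  conv-sucʳ u v (suc i) = ≡.trans (𝕂.+-congˡ (conv-sucʳ (u ∘ suc) v i))
    (solve 3 (λ a b c → a :+ (b :+ c) := b :+ (a :+ c)) ≡.refl _ _ _)

  conv-comm : ∀ u v i → conv u v i ≡ conv v u i
  conv-comm u v zero    = 𝕂.*-comm _ _
  conv-comm u v (suc i) = ≡.trans (cong₂ _+_ (𝕂.*-comm _ _) (conv-comm (u ∘ suc) v i)) (≡.sym (conv-sucʳ v u i))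

  conv-assoc : ∀ u v w i → conv (conv u v) w i ≡ conv u (conv v w) i
  conv-assoc u v w zero    = 𝕂.*-assoc _ _ _
  conv-assoc u v w (suc i) = begin
    (u 0 * v 0) * w (suc i) + conv (λ j → u 0 * v (suc j) + conv (u ∘ suc) v j) w i
      ≡⟨ 𝕂.+-congˡ (conv-+ˡ _ _ w i) ⟩
    (u 0 * v 0) * w (suc i) + (conv (λ j → u 0 * v (suc j)) w i + conv (conv (u ∘ suc) v) w i)
      ≡⟨ 𝕂.+-congˡ (cong₂ _+_ (conv-scaleˡ (u 0) (v ∘ suc) w i) (conv-assoc (u ∘ suc) v w i)) ⟩
    (u 0 * v 0) * w (suc i) + (u 0 * conv (v ∘ suc) w i + conv (u ∘ suc) (conv v w) i)
      ≡⟨ solve 5 (λ a b c x y → (a :* b) :* c :+ (a :* x :+ y) := a :* (b :* c :+ x) :+ y) ≡.refl (u 0) (v 0) (w (suc i)) _ _ ⟩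
    u 0 * conv v w (suc i) + conv (u ∘ suc) (conv v w) i ∎
    where open ≡.≡-Reasoning

  coeff-*P : ∀ p q i → coeff (p *P q) i ≡ conv (coeff p) (coeff q) i
  coeff-*P []      q i       = ≡.sym (conv-zeroˡ (coeff q) i)
  coeff-*P (a ∷ p) q zero    = ≡.trans (coeff-+P (scaleP a q) _ 0)
    (≡.trans (𝕂.+-identityʳ _) (coeff-scale a q 0))
  coeff-*P (a ∷ p) q (suc i) = ≡.trans (coeff-+P (scaleP a q) _ (suc i))
    (cong₂ _+_ (coeff-scale a q (suc i)) (coeff-*P p q i))

  *-via-conv : ∀ {p q p' q'} → (∀ i → conv (coeff p) (coeff q) i ≡ conv (coeff p') (coeff q') i) → (p *P q) ≋ (p' *P q')
  *-via-conv {p} {q} {p'} {q'} eq = mk≋ λ i → ≡.trans (coeff-*P p q i) (≡.trans (eq i) (≡.sym (coeff-*P p' q' i)))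

  +P-cong : ∀ {p p' q q'} → p ≋ p' → q ≋ q' → (p +P q) ≋ (p' +P q')
  +P-cong {p} {p'} {q} {q'} ep eq = mk≋ λ i →
    ≡.trans (coeff-+P p q i) (≡.trans (cong₂ _+_ (coeff≡ ep i) (coeff≡ eq i)) (≡.sym (coeff-+P p' q' i)))

  +P-comm : ∀ p q → (p +P q) ≋ (q +P p)
  +P-comm p q = mk≋ λ i → ≡.trans (coeff-+P p q i) (≡.trans (𝕂.+-comm _ _) (≡.sym (coeff-+P q p i)))

  +P-assoc : ∀ p q r → ((p +P q) +P r) ≋ (p +P (q +P r))
  +P-assoc p q r = mk≋ λ i → ≡.trans (coeff-+P (p +P q) r i) (≡.trans (cong (_+ coeff r i) (coeff-+P p q i))
    (≡.trans (𝕂.+-assoc _ _ _) (≡.sym (≡.trans (coeff-+P p (q +P r) i) (cong (coeff p i +_) (coeff-+P q r i))))))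

  negP-inverse : ∀ p → (negP p +P p) ≋ []
  negP-inverse p = mk≋ λ i → ≡.trans (coeff-+P (negP p) p i) (≡.trans (𝕂.+-congʳ (coeff-negP p i)) (𝕂.-‿inverseˡ _))

  *P-comm : ∀ p q → (p *P q) ≋ (q *P p)
  *P-comm p q = *-via-conv {p} {q} {q} {p} (conv-comm (coeff p) (coeff q))

  *P-identityˡ : ∀ p → (oneP *P p) ≋ p
  *P-identityˡ p = mk≋ λ where
    zero    → ≡.trans (coeff-*P oneP p 0) (𝕂.*-identityˡ _)
    (suc i) → ≡.trans (coeff-*P oneP p (suc i))
      (≡.trans (cong₂ _+_ (𝕂.*-identityˡ _) (conv-zeroˡ (coeff p) i)) (𝕂.+-identityʳ _))

  *P-assoc : ∀ p q r → ((p *P q) *P r) ≋ (p *P (q *P r))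
  *P-assoc p q r = *-via-conv {p *P q} {r} {p} {q *P r} λ i →
    ≡.trans (conv-cong (coeff-*P p q) (λ _ → ≡.refl) i) (≡.trans (conv-assoc (coeff p) (coeff q) (coeff r) i)
      (≡.sym (conv-cong (λ _ → ≡.refl) (coeff-*P q r) i)))

  *P-distribʳ : ∀ r p q → ((p +P q) *P r) ≋ ((p *P r) +P (q *P r))
  *P-distribʳ r p q = mk≋ λ i → ≡.trans (coeff-*P (p +P q) r i) (≡.trans (conv-cong (coeff-+P p q) (λ _ → ≡.refl) i)
    (≡.trans (conv-+ˡ _ _ _ i) (≡.sym (≡.trans (coeff-+P (p *P r) (q *P r) i) (cong₂ _+_ (coeff-*P p r i) (coeff-*P q r i))))))

  ≋-refl : ∀ {p} → p ≋ p
  ≋-refl = mk≋ λ _ → ≡.refl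

  ≋-sym : ∀ {p q} → p ≋ q → q ≋ p
  ≋-sym e = mk≋ λ i → ≡.sym (coeff≡ e i)

  ≋-trans : ∀ {p q r} → p ≋ q → q ≋ r → p ≋ r
  ≋-trans e f = mk≋ λ i → ≡.trans (coeff≡ e i) (coeff≡ f i)

  -- Copies of the list operations that do not unfold, so that unification can
  -- solve for the arguments of the ring laws.
  infixl 6 _⊕_
  infixl 7 _⊗_
  opaque
    _⊕_ _⊗_ : Poly → Poly → Poly
    _⊕_ = _+P_
    _⊗_ = _*P_

    ⊖_ : Poly → Poly
    ⊖_ = negP

    ⊕≡+P : ∀ p q → p ⊕ q ≡ p +P q
    ⊕≡+P p q = ≡.refl

    ⊗≡*P : ∀ p q → p ⊗ q ≡ p *P q
    ⊗≡*P p q = ≡.refl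

    ⊖≡negP : ∀ p → ⊖ p ≡ negP p
    ⊖≡negP p = ≡.refl

    coeff-+ : ∀ p q i → coeff (p ⊕ q) i ≡ coeff p i + coeff q i
    coeff-+ = coeff-+P

    coeff-* : ∀ p q i → coeff (p ⊗ q) i ≡ conv (coeff p) (coeff q) i
    coeff-* = coeff-*P

    coeff-neg : ∀ p i → coeff (⊖ p) i ≡ - coeff p i
    coeff-neg = coeff-negP

    ⊕-⊗-isCommutativeRing : IsCommutativeRing _≋_ _⊕_ _⊗_ ⊖_ [] oneP
    ⊕-⊗-isCommutativeRing = record
      { isRing = record
        { +-isAbelianGroup = record
          { isGroup = record
            { isMonoid = record
              { isSemigroup = record
                { isMagma = record
                  { isEquivalence = record { refl = ≋-refl ; sym = ≋-sym ; trans = ≋-trans }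
                  ; ∙-cong = +P-cong }
                ; assoc = +P-assoc }
              ; identity = (λ _ → ≋-refl) , (λ p → +P-comm p []) }
            ; inverse = negP-inverse , (λ p → ≋-trans (+P-comm p (negP p)) (negP-inverse p))
            ; ⁻¹-cong = λ {p} {q} e → mk≋ λ i →
                ≡.trans (coeff-negP p i) (≡.trans (cong -_ (coeff≡ e i)) (≡.sym (coeff-negP q i))) }
          ; comm = +P-comm }
        ; *-cong = λ {p} {p'} {q} {q'} e f → *-via-conv {p} {q} {p'} {q'} (conv-cong (coeff≡ e) (coeff≡ f))
        ; *-assoc = *P-assoc
        ; *-identity = *P-identityˡ , (λ p → ≋-trans (*P-comm p oneP) (*P-identityˡ p))
        ; distrib = (λ r p q → ≋-trans (*P-comm r (p +P q)) (≋-trans (*P-distribʳ r p q)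
                      (+P-cong (*P-comm p r) (*P-comm q r))))
                  , *P-distribʳ }
      ; *-comm = *P-comm }

  polyRing : CommutativeRing 0ℓ 0ℓ
  polyRing = record { isCommutativeRing = ⊕-⊗-isCommutativeRing }

  ≈P⇒≋ : ∀ {p q} → p ≈P q → p ≋ q
  ≈P⇒≋ {p} {q} e = mk≋ (go p q e)
    where
    go : ∀ p q → p ≈P q → ∀ i → coeff p i ≡ coeff q i
    go []      []      e i = ≡.refl
    go []      (b ∷ q) e i with FiniteField._≟_ 𝔽 b 0#
    go []      (b ∷ q) e zero    | yes b≡0 = ≡.sym b≡0
    go []      (b ∷ q) e (suc i) | yes b≡0 = go [] q e i
    go (a ∷ p) []      e i with FiniteField._≟_ 𝔽 a 0#
    go (a ∷ p) []      e zero    | yes a≡0 = a≡0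
    go (a ∷ p) []      e (suc i) | yes a≡0 = go p [] e i
    go (a ∷ p) (b ∷ q) e i with FiniteField._≟_ 𝔽 a b
    go (a ∷ p) (b ∷ q) e zero    | yes a≡b = a≡b
    go (a ∷ p) (b ∷ q) e (suc i) | yes a≡b = go p q e i

  ≋⇒≈P : ∀ {p q} → p ≋ q → p ≈P q
  ≋⇒≈P {p} {q} e = go p q (coeff≡ e)
    where
    go : ∀ p q → (∀ i → coeff p i ≡ coeff q i) → p ≈P q
    go []      []      e = ≡.refl
    go []      (b ∷ q) e with FiniteField._≟_ 𝔽 b 0#
    ... | yes _  = go [] q (e ∘ suc)
    ... | no b≢0 with () ← b≢0 (≡.sym (e 0))
    go (a ∷ p) []      e with FiniteField._≟_ 𝔽 a 0#
    ... | yes _  = go p [] (e ∘ suc)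
    ... | no a≢0 with () ← a≢0 (e 0)
    go (a ∷ p) (b ∷ q) e with FiniteField._≟_ 𝔽 a b
    ... | yes _  = go p q (e ∘ suc)
    ... | no a≢b with () ← a≢b (e 0)

-- Homogenization and determinants with linear entries.

module Homogenization (𝔽 : FiniteField) where
  open Over 𝔽
  open PolynomialRing 𝔽
  open CommutativeRing polyRing hiding (zero)
  open Determinant polyRing
  open import Relation.Binary.Reasoning.Setoid setoid
  open import Algebra.Properties.Ring ring using (-‿distribˡ-*; -0#≈0#; -1*x≈-x)
  open import Algebra.Solver.Ring.NaturalCoefficients.Default commutativeSemiring
    using (solve; _:=_; _:+_; _:*_)
  private
    module 𝕂 = CommutativeRing fieldRing
  import Algebra.Properties.Ring 𝕂.ring as 𝕂P

  constP-0 : constP 𝕂.0# ≈ 0#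
  constP-0 = mk≋ λ { zero → ≡.refl ; (suc i) → ≡.refl }

  constP-neg : ∀ a → constP (𝕂.- a) ≈ - constP a
  constP-neg a = mk≋ λ where
    zero    → ≡.sym (coeff-neg (constP a) 0)
    (suc i) → ≡.sym (≡.trans (coeff-neg (constP a) (suc i)) 𝕂P.-0#≈0#)

  scaleP≈* : ∀ a p → scaleP a p ≈ constP a * p
  scaleP≈* a p = mk≋ λ where
    zero    → ≡.trans (coeff-scale a p 0) (≡.sym (coeff-* (constP a) p 0))
    (suc i) → ≡.trans (coeff-scale a p (suc i)) (≡.sym (≡.trans (coeff-* (constP a) p (suc i))
      (≡.trans (𝕂.+-congˡ (conv-zeroˡ (coeff p) i)) (𝕂.+-identityʳ _))))

  constP-+ : ∀ a b → constP (a 𝕂.+ b) ≈ constP a + constP b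
  constP-+ a b = mk≋ λ where
    zero    → ≡.sym (coeff-+ (constP a) (constP b) 0)
    (suc i) → ≡.sym (≡.trans (coeff-+ (constP a) (constP b) (suc i)) (𝕂.+-identityˡ _))

  constP-* : ∀ a b → constP (a 𝕂.* b) ≈ constP a * constP b
  constP-* a b = scaleP≈* a (constP b)

  X*≈shift : ∀ p → XP * p ≈ 𝕂.0# ∷ p
  X*≈shift p = mk≋ λ where
    zero    → ≡.trans (coeff-* XP p 0) (𝕂.zeroˡ _)
    (suc i) → ≡.trans (coeff-* XP p (suc i)) (≡.trans (cong₂ 𝕂._+_ (𝕂.zeroˡ _)
      (≡.sym (coeff-* oneP p i))) (≡.trans (𝕂.+-identityˡ _) (coeff≡ (*-identityˡ p) i)))

  Deg≤ : ℕ → Poly → Set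
  Deg≤ d p = ∀ i → d < i → coeff p i ≡ 𝕂.0#

  Deg≤-resp : ∀ {d p q} → p ≈ q → Deg≤ d q → Deg≤ d p
  Deg≤-resp p≈q deg i d<i = ≡.trans (coeff≡ p≈q i) (deg i d<i)

  Deg≤-0 : ∀ {d} → Deg≤ d 0#
  Deg≤-0 _ _ = ≡.refl

  Deg≤-+ : ∀ {d p q} → Deg≤ d p → Deg≤ d q → Deg≤ d (p + q)
  Deg≤-+ {p = p} {q} degp degq i d<i =
    ≡.trans (coeff-+ p q i) (≡.trans (cong₂ 𝕂._+_ (degp i d<i) (degq i d<i)) (𝕂.+-identityˡ _))

  Deg≤-neg : ∀ {d p} → Deg≤ d p → Deg≤ d (- p)
  Deg≤-neg {p = p} deg i d<i = ≡.trans (coeff-neg p i) (≡.trans (cong 𝕂.-_ (deg i d<i)) 𝕂P.-0#≈0#)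

  Deg≤-scale : ∀ {d p} a → Deg≤ d p → Deg≤ d (scaleP a p)
  Deg≤-scale {p = p} a deg i d<i = ≡.trans (coeff-scale a p i) (≡.trans (cong (a 𝕂.*_) (deg i d<i)) (𝕂.zeroʳ a))

  Deg≤-sign : ∀ {d p} j → Deg≤ d p → Deg≤ d (sign j * p)
  Deg≤-sign {p = p} zero    deg = Deg≤-resp (*-identityˡ p) deg
  Deg≤-sign {p = p} (suc j) deg = Deg≤-resp (sym (-‿distribˡ-* (sign j) p)) (Deg≤-neg {p = sign j * p} (Deg≤-sign j deg))

  Deg≤-∑ : ∀ {d} n f → (∀ j → Deg≤ d (f j)) → Deg≤ d (∑ n f)
  Deg≤-∑ {d} zero    f deg = Deg≤-resp {d} (∑-zero 0 λ ()) (Deg≤-0 {d})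
  Deg≤-∑ (suc n) f deg = Deg≤-resp (∑-suc n f) (Deg≤-+ {p = f 0} (deg 0) (Deg≤-∑ n (f ∘ suc) (deg ∘ suc)))

  -- Turns a product with a linear factor into scalings and one shift, operations whose effect on
  -- degrees and on homogenizations is immediate.
  linear-* : ∀ {p} q → Deg≤ 1 p → p * q ≈ scaleP (coeff p 0) q + (𝕂.0# ∷ scaleP (coeff p 1) q)
  linear-* {p} q deg = begin
    p * q
      ≈⟨ *-congʳ p≈ ⟩
    (a ∷ b ∷ []) * q
      ≈⟨ mk≋ (λ where
           zero    → ≡.trans (coeff-* (a ∷ b ∷ []) q 0) (≡.sym (≡.trans (coeff-+ (scaleP a q) _ 0)
             (≡.trans (𝕂.+-identityʳ _) (coeff-scale a q 0))))
           (suc i) → ≡.trans (coeff-* (a ∷ b ∷ []) q (suc i)) (≡.sym (≡.trans (coeff-+ (scaleP a q) _ (suc i))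
             (cong₂ 𝕂._+_ (coeff-scale a q (suc i))
               (≡.trans (coeff≡ (scaleP≈* b q) i) (coeff-* (constP b) q i)))))) ⟩
    scaleP a q + (𝕂.0# ∷ scaleP b q) ∎
    where
    a = coeff p 0
    b = coeff p 1
    p≈ : p ≈ a ∷ b ∷ []
    p≈ = mk≋ λ { zero → ≡.refl ; (suc zero) → ≡.refl ; (suc (suc i)) → deg (suc (suc i)) (s≤s (s≤s z≤n)) }

  Deg≤-linear-* : ∀ {d p q} → Deg≤ 1 p → Deg≤ d q → Deg≤ (suc d) (p * q)
  Deg≤-linear-* {p = p} {q} degp degq (suc i) (s≤s d<i) = ≡.trans (coeff≡ (linear-* q degp) (suc i))
    (≡.trans (coeff-+ (scaleP (coeff p 0) q) _ (suc i))
      (≡.trans (cong₂ 𝕂._+_ (Deg≤-scale {p = q} (coeff p 0) degq (suc i) (ℕ.m<n⇒m<1+n d<i)) (Deg≤-scale {p = q} (coeff p 1) degq i d<i))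
        (𝕂.+-identityˡ _)))

  -- homogenize d u is Σ_{i ≤ d} u_i Yⁱ g^{d-i}, in Horner form.
  module _ (g Y : Poly) where

    homogenize : ℕ → (ℕ → F) → Poly
    homogenize zero    u = constP (u 0)
    homogenize (suc d) u = constP (u 0) * g ^ suc d + Y * homogenize d (u ∘ suc)

    homogenize-cong : ∀ d {u v} → (∀ i → u i ≡ v i) → homogenize d u ≈ homogenize d v
    homogenize-cong zero    u≡v = reflexive (cong constP (u≡v 0))
    homogenize-cong (suc d) u≡v =
      +-cong (*-congʳ (reflexive (cong constP (u≡v 0)))) (*-congˡ (homogenize-cong d (u≡v ∘ suc)))

    homogenize-0 : ∀ d → homogenize d (λ _ → 𝕂.0#) ≈ 0#
    homogenize-0 zero    = constP-0
    homogenize-0 (suc d) = trans (+-cong (trans (*-congʳ constP-0) (zeroˡ _))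
      (trans (*-congˡ (homogenize-0 d)) (zeroʳ Y))) (+-identityˡ 0#)

    homogenize-+ : ∀ d u v → homogenize d (λ i → u i 𝕂.+ v i) ≈ homogenize d u + homogenize d v
    homogenize-+ zero    u v = constP-+ (u 0) (v 0)
    homogenize-+ (suc d) u v = trans
      (+-cong (*-congʳ (constP-+ (u 0) (v 0))) (*-congˡ (homogenize-+ d (u ∘ suc) (v ∘ suc))))
      (solve 6 (λ a b c y s t → (a :+ b) :* c :+ y :* (s :+ t) := (a :* c :+ y :* s) :+ (b :* c :+ y :* t)) refl
        (constP (u 0)) (constP (v 0)) (g ^ suc d) Y (homogenize d (u ∘ suc)) (homogenize d (v ∘ suc)))

    homogenize-scale : ∀ d a u → homogenize d (λ i → a 𝕂.* u i) ≈ constP a * homogenize d u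
    homogenize-scale zero    a u = constP-* a (u 0)
    homogenize-scale (suc d) a u = trans
      (+-cong (*-congʳ (constP-* a (u 0))) (*-congˡ (homogenize-scale d a (u ∘ suc))))
      (solve 5 (λ a b c y s → (a :* b) :* c :+ y :* (a :* s) := a :* (b :* c :+ y :* s)) refl
        (constP a) (constP (u 0)) (g ^ suc d) Y (homogenize d (u ∘ suc)))

    homogenize-raise : ∀ d u → u (suc d) ≡ 𝕂.0# → homogenize (suc d) u ≈ g * homogenize d u
    homogenize-raise zero    u u≡0 = begin
      constP (u 0) * (g * 1#) + Y * constP (u 1)
        ≈⟨ +-cong (trans (*-congˡ (*-identityʳ g)) (*-comm _ g))
                  (trans (*-congˡ (trans (reflexive (cong constP u≡0)) constP-0)) (zeroʳ Y)) ⟩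
      g * constP (u 0) + 0#
        ≈⟨ +-identityʳ _ ⟩
      g * constP (u 0) ∎
    homogenize-raise (suc d) u u≡0 = trans (+-congˡ (*-congˡ (homogenize-raise d (u ∘ suc) u≡0)))
      (solve 5 (λ a g c y s → a :* (g :* c) :+ y :* (g :* s) := g :* (a :* c :+ y :* s)) refl
        (constP (u 0)) g (g ^ suc d) Y (homogenize d (u ∘ suc)))

    homP : ℕ → Poly → Poly
    homP d p = homogenize d (coeff p)

    homP-cong : ∀ d {p q} → p ≈ q → homP d p ≈ homP d q
    homP-cong d p≈q = homogenize-cong d (coeff≡ p≈q)

    homP-+ : ∀ d p q → homP d (p + q) ≈ homP d p + homP d q
    homP-+ d p q = trans (homogenize-cong d (coeff-+ p q)) (homogenize-+ d (coeff p) (coeff q))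

    homP-scale : ∀ d a p → homP d (scaleP a p) ≈ constP a * homP d p
    homP-scale d a p = trans (homogenize-cong d (coeff-scale a p)) (homogenize-scale d a (coeff p))

    homP-neg : ∀ d p → homP d (- p) ≈ - homP d p
    homP-neg d p = begin
      homP d (- p)                  ≈⟨ homP-cong d (sym (trans (scaleP≈* (𝕂.- 𝕂.1#) p) (trans (*-congʳ (constP-neg _)) (-1*x≈-x p)))) ⟩
      homP d (scaleP (𝕂.- 𝕂.1#) p)  ≈⟨ trans (homP-scale d _ p) (*-congʳ (constP-neg _)) ⟩
      - 1# * homP d p               ≈⟨ -1*x≈-x _ ⟩
      - homP d p                    ∎

    homP-sign : ∀ d j p → homP d (sign j * p) ≈ sign j * homP d p
    homP-sign d zero    p = trans (homP-cong d (*-identityˡ p)) (sym (*-identityˡ _))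
    homP-sign d (suc j) p = begin
      homP d (- sign j * p)     ≈⟨ homP-cong d (-‿distribˡ-* (sign j) p) ⟨
      homP d (- (sign j * p))   ≈⟨ homP-neg d (sign j * p) ⟩
      - homP d (sign j * p)     ≈⟨ -‿cong (homP-sign d j p) ⟩
      - (sign j * homP d p)     ≈⟨ -‿distribˡ-* _ _ ⟩
      - sign j * homP d p       ∎

    homP-∑ : ∀ d n f → homP d (∑ n f) ≈ ∑ n (λ j → homP d (f j))
    homP-∑ d zero    f = trans (homP-cong d (∑-zero 0 λ ())) (trans (homogenize-0 d) (sym (∑-zero 0 λ ())))
    homP-∑ d (suc n) f = begin
      homP d (∑ (suc n) f)                           ≈⟨ homP-cong d (∑-suc n f) ⟩
      homP d (f 0 + ∑ n (f ∘ suc))                   ≈⟨ homP-+ d (f 0) _ ⟩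
      homP d (f 0) + homP d (∑ n (f ∘ suc))          ≈⟨ +-congˡ (homP-∑ d n (f ∘ suc)) ⟩
      homP d (f 0) + ∑ n (λ j → homP d (f (suc j)))  ≈⟨ ∑-suc n _ ⟨
      ∑ (suc n) (λ j → homP d (f j))                 ∎

    homP-linear-* : ∀ d p q → Deg≤ 1 p → Deg≤ d q → homP (suc d) (p * q) ≈ homP 1 p * homP d q
    homP-linear-* d p q degp degq = begin
      homP (suc d) (p * q)
        ≈⟨ homP-cong (suc d) (linear-* q degp) ⟩
      homP (suc d) (scaleP a q + (𝕂.0# ∷ scaleP b q))
        ≈⟨ homP-+ (suc d) (scaleP a q) _ ⟩
      homP (suc d) (scaleP a q) + (constP 𝕂.0# * g ^ suc d + Y * homP d (scaleP b q))
        ≈⟨ +-cong (trans (homP-scale (suc d) a q) (*-congˡ (homogenize-raise d (coeff q) (degq (suc d) ℕ.≤-refl))))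
                  (trans (+-cong (trans (*-congʳ constP-0) (zeroˡ _)) (*-congˡ (homP-scale d b q))) (+-identityˡ _)) ⟩
      constP a * (g * homP d q) + Y * (constP b * homP d q)
        ≈⟨ solve 5 (λ a g h y b → a :* (g :* h) :+ y :* (b :* h) := (a :* g :+ y :* b) :* h) refl
             (constP a) g (homP d q) Y (constP b) ⟩
      (constP a * g + Y * constP b) * homP d q
        ≈⟨ *-congʳ (+-congʳ (*-congˡ (*-identityʳ g))) ⟨
      homP 1 p * homP d q ∎
      where
      a = coeff p 0
      b = coeff p 1

  Deg≤-det : ∀ k P → (∀ r s → Deg≤ 1 (P r s)) → Deg≤ k (det k P)
  Deg≤-det zero    P deg (suc i) _ = ≡.refl
  Deg≤-det (suc k) P deg = Deg≤-∑ (suc k) _ λ j → Deg≤-sign j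
    (Deg≤-linear-* {p = P 0 j} (deg 0 j) (Deg≤-det k (minorOf j P) λ r s → deg (suc r) (punch j s)))

  -- Induction along the top row: an entry is homogenized in degree 1 and its minor in degree k,
  -- which together give degree k + 1. There is no division by g, so g = 0 is allowed.
  homP-det : ∀ g Y k P → (∀ r s → Deg≤ 1 (P r s)) →
    homP g Y k (det k P) ≈ det k (λ r s → homP g Y 1 (P r s))
  homP-det g Y zero    P deg = refl
  homP-det g Y (suc k) P deg = trans (homP-∑ g Y (suc k) (suc k) _) (∑-cong (suc k) λ {j} _ →
    let degMinor = λ r s → deg (suc r) (punch j s) in
    trans (homP-sign g Y (suc k) j _) (*-congˡ
      (trans (homP-linear-* g Y k (P 0 j) _ (deg 0 j) (Deg≤-det k (minorOf j P) degMinor))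
             (*-congˡ (homP-det g Y k (minorOf j P) degMinor)))))

  charEntry : (ℕ → ℕ → F) → Matrix
  charEntry β r s = XP * δ r s + - constP (β r s)

  coeff-δ : ∀ r s i → coeff (δ r s) (suc i) ≡ 𝕂.0#
  coeff-δ r s i with r ℕ.≡ᵇ s
  ... | true  = ≡.refl
  ... | false = ≡.refl

  constP-δ : ∀ r s → constP (coeff (δ r s) 0) ≈ δ r s
  constP-δ r s with r ℕ.≡ᵇ s
  ... | true  = refl
  ... | false = constP-0

  charEntry≈ : ∀ β r s → charEntry β r s ≈ (𝕂.- β r s) ∷ δ r s
  charEntry≈ β r s = trans (+-cong (X*≈shift (δ r s)) (sym (constP-neg (β r s)))) (mk≋ λ where
    zero    → ≡.trans (coeff-+ (𝕂.0# ∷ δ r s) (constP (𝕂.- β r s)) 0) (𝕂.+-identityˡ _)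
    (suc i) → ≡.trans (coeff-+ (𝕂.0# ∷ δ r s) (constP (𝕂.- β r s)) (suc i)) (𝕂.+-identityʳ _))

  Deg≤-charEntry : ∀ β r s → Deg≤ 1 (charEntry β r s)
  Deg≤-charEntry β r s (suc (suc i)) _ = ≡.trans (coeff≡ (charEntry≈ β r s) (suc (suc i))) (coeff-δ r s i)
  Deg≤-charEntry β r s (suc zero) (s≤s ())

  homP-charEntry : ∀ g Y β r s → homP g Y 1 (charEntry β r s) ≈ Y * δ r s + - (g * constP (β r s))
  homP-charEntry g Y β r s = begin
    homP g Y 1 (charEntry β r s)
      ≈⟨ homP-cong g Y 1 (charEntry≈ β r s) ⟩
    constP (𝕂.- β r s) * (g * 1#) + Y * constP (coeff (δ r s) 0)
      ≈⟨ +-cong (trans (trans (*-congʳ (constP-neg _)) (sym (-‿distribˡ-* _ _))) (-‿cong (trans (*-congˡ (*-identityʳ g)) (*-comm _ g))))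
                (*-congˡ (constP-δ r s)) ⟩
    - (g * constP (β r s)) + Y * δ r s
      ≈⟨ +-comm _ _ ⟩
    Y * δ r s + - (g * constP (β r s)) ∎

  charDet : ℕ → (ℕ → ℕ → F) → Poly
  charDet m β = det m (charEntry β)

  homP-charDet : ∀ g Y m β → homP g Y m (charDet m β) ≈ det m (λ r s → Y * δ r s + - (g * constP (β r s)))
  homP-charDet g Y m β = trans (homP-det g Y m (charEntry β) (Deg≤-charEntry β))
    (det-cong m λ {r} {s} _ _ → homP-charEntry g Y β r s)

  Deg≤-charDet : ∀ m β → Deg≤ m (charDet m β)
  Deg≤-charDet m β = Deg≤-det m (charEntry β) (Deg≤-charEntry β)

  homogenize-01 : ∀ d u → homogenize 0# 1# d u ≈ constP (u d)
  homogenize-01 zero    u = refl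
  homogenize-01 (suc d) u = begin
    constP (u 0) * (0# * 0# ^ d) + 1# * homogenize 0# 1# d (u ∘ suc)
      ≈⟨ +-cong (trans (*-congˡ (zeroˡ _)) (zeroʳ (constP (u 0)))) (trans (*-identityˡ _) (homogenize-01 d (u ∘ suc))) ⟩
    0# + constP (u (suc d))
      ≈⟨ +-identityˡ _ ⟩
    constP (u (suc d)) ∎

  1^n≈1 : ∀ n → 1# ^ n ≈ 1#
  1^n≈1 zero    = refl
  1^n≈1 (suc n) = trans (*-identityˡ _) (1^n≈1 n)

  -- At g = 0 and Y = 1 the homogenization of X I - B is the identity, and it reads
  -- off the leading coefficient.
  charDet-monic : ∀ m β → coeff (charDet m β) m ≡ 𝕂.1#
  charDet-monic m β = coeff≡ (begin
    constP (coeff (charDet m β) m)                        ≈⟨ homogenize-01 m _ ⟨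
    homP 0# 1# m (charDet m β)                            ≈⟨ homP-charDet 0# 1# m β ⟩
    det m (λ r s → 1# * δ r s + - (0# * constP (β r s)))  ≈⟨ det-cong m (λ _ _ → trans (+-congˡ (trans (-‿cong (zeroˡ _)) -0#≈0#)) (+-identityʳ _)) ⟩
    det m (λ r s → 1# * δ r s)                            ≈⟨ det-scalar m 1# ⟩
    1# ^ m                                                ≈⟨ 1^n≈1 m ⟩
    1#                                                    ∎) 0

-- Characteristic polynomials as determinants.

module CharacteristicPolynomial (𝔽 : FiniteField) where
  open Over 𝔽
  open PolynomialRing 𝔽
  open Homogenization 𝔽
  open CommutativeRing polyRing hiding (zero)
  open Determinant polyRing
  open import Relation.Binary.Reasoning.Setoid setoid
  open import Algebra.Properties.Ring ring using (-‿distribˡ-*; -‿distribʳ-*)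
  open import Algebra.Properties.Semiring.Exp semiring using (^-assocʳ)
  open import Algebra.Solver.Ring.NaturalCoefficients.Default commutativeSemiring
    using (solve; _:=_; _:*_)
  private
    module 𝕂 = CommutativeRing fieldRing

  expand : ∀ k → (Fin (suc k) → Fin (suc k) → Poly) → ∀ r → (Fin r → Fin (suc k)) → Poly → Poly
  expand k M zero    col s = []
  expand k M (suc r) col s =
    (s *P (M zero (col zero) *P detP k (minor M (col zero)))) +P
    expand k M r (λ i → col (suc i)) (negP s)

  leading : ∀ k → (Fin (2 ℕ.+ k) → Fin (2 ℕ.+ k) → Poly) → Fin (2 ℕ.+ k) → Poly → Poly
  leading k M j s = s *P (M zero j *P detP (suc k) (minor M j))

  -- The loop inside detP has no name outside Defs.  Unification reads off the value of
  -- its tail after two columns, abstracting the arguments of that tail (in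
  -- loop≡expand-tail) makes them distinct variables, and so the hole in the type of
  -- loop≡expand is solved by the loop itself.
  tail : ∀ k M → ∃ λ t → detP (2 ℕ.+ k) M ≡ leading k M zero oneP +P (leading k M (suc zero) (negP oneP) +P t)
  tail k M = _ , ≡.refl

  loop≡expand : ∀ k M r col s → _ ≡ expand k M r col s
  loop≡expand-tail : ∀ k M → proj₁ (tail k M) ≡ expand (suc k) M k (λ i → suc (suc i)) (negP (negP oneP))
  loop≡expand-tail k M with suc k | (λ (i : Fin k) → Fin.suc (Fin.suc i)) | negP (negP oneP)
  ... | k' | col | s = loop≡expand k' M k col s
  loop≡expand k M zero    col s = ≡.refl
  loop≡expand k M (suc r) col s =
    cong ((s *P (M zero (col zero) *P detP k (minor M (col zero)))) +P_) (loop≡expand k M r (λ i → col (suc i)) (negP s))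

  detP≡expand : ∀ k M → detP (suc k) M ≡ expand k M (suc k) (λ j → j) oneP
  detP≡expand zero    M = ≡.refl
  detP≡expand (suc k) M = ≡.trans (proj₂ (tail k M))
    (cong (λ t → leading k M zero oneP +P (leading k M (suc zero) (negP oneP) +P t)) (loop≡expand-tail k M))

  +P≈+ : ∀ p q → p +P q ≈ p + q
  +P≈+ p q = reflexive (≡.sym (⊕≡+P p q))

  *P≈* : ∀ p q → p *P q ≈ p * q
  *P≈* p q = reflexive (≡.sym (⊗≡*P p q))

  negP≈- : ∀ p → negP p ≈ - p
  negP≈- p = reflexive (≡.sym (⊖≡negP p))

  ^P≈^ : ∀ p n → p ^P n ≈ p ^ n
  ^P≈^ p zero    = refl
  ^P≈^ p (suc n) = trans (*P≈* p (p ^P n)) (*-congˡ (^P≈^ p n))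

  -- The running sign `s` is kept as a factor outside `sign j`: each turn of the loop negates `s`
  -- and shifts `T`, and that negation is absorbed into `sign (suc j)`.
  expand≈∑ : ∀ k M r col s (T : ℕ → Poly) → (∀ i → M zero (col i) *P detP k (minor M (col i)) ≈ T (toℕ i)) →
    expand k M r col s ≈ ∑ r (λ j → s * (sign j * T j))
  expand≈∑ k M zero    col s T eq = sym (∑-zero 0 λ ())
  expand≈∑ k M (suc r) col s T eq = begin
    (s *P A) +P expand k M r (col ∘ suc) (negP s)
      ≈⟨ +P≈+ _ _ ⟩
    s *P A + expand k M r (col ∘ suc) (negP s)
      ≈⟨ +-cong (trans (*P≈* s A) (*-congˡ (trans (eq zero) (sym (*-identityˡ _)))))
                (expand≈∑ k M r (col ∘ suc) (negP s) (T ∘ suc) (eq ∘ suc)) ⟩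
    s * (1# * T 0) + ∑ r (λ j → negP s * (sign j * T (suc j)))
      ≈⟨ +-congˡ (∑-cong r λ {j} _ → begin
           negP s * (sign j * T (suc j))     ≈⟨ *-congʳ (negP≈- s) ⟩
           - s * (sign j * T (suc j))        ≈⟨ -‿distribˡ-* _ _ ⟨
           - (s * (sign j * T (suc j)))      ≈⟨ -‿distribʳ-* _ _ ⟩
           s * - (sign j * T (suc j))        ≈⟨ *-congˡ (-‿distribˡ-* _ _) ⟩
           s * (sign (suc j) * T (suc j))    ∎) ⟩
    s * (1# * T 0) + ∑ r (λ j → s * (sign (suc j) * T (suc j)))
      ≈⟨ ∑-suc r _ ⟨
    ∑ (suc r) (λ j → s * (sign j * T j)) ∎
    where A = M zero (col zero) *P detP k (minor M (col zero))

  toℕ-punchIn : ∀ {k} (j : Fin (suc k)) (i : Fin k) → toℕ (Fin.punchIn j i) ≡ punch (toℕ j) (toℕ i)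
  toℕ-punchIn zero    i       = ≡.refl
  toℕ-punchIn (suc j) zero    = ≡.refl
  toℕ-punchIn (suc j) (suc i) = cong suc (toℕ-punchIn j i)

  detP≈det : ∀ k M N → (∀ i j → M i j ≈ N (toℕ i) (toℕ j)) → detP k M ≈ det k N
  detP≈det zero    M N M≈N = refl
  detP≈det (suc k) M N M≈N = begin
    detP (suc k) M
      ≡⟨ detP≡expand k M ⟩
    expand k M (suc k) (λ j → j) oneP
      ≈⟨ expand≈∑ k M (suc k) (λ j → j) oneP (λ j → N 0 j * det k (minorOf j N)) (λ j →
           trans (*P≈* _ _) (*-cong (M≈N zero j) (detP≈det k (minor M j) (minorOf (toℕ j) N) λ r i →
             trans (M≈N (suc r) (Fin.punchIn j i)) (reflexive (cong (N (suc (toℕ r))) (toℕ-punchIn j i)))))) ⟩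
    ∑ (suc k) (λ j → 1# * (sign j * (N 0 j * det k (minorOf j N))))
      ≈⟨ ∑-cong (suc k) (λ _ → *-identityˡ _) ⟩
    det (suc k) N ∎

  δ-refl : ∀ r → δ r r ≡ 1#
  δ-refl r = cong (λ b → if b then 1# else 0#) (≡ᵇ-refl r)

  charPoly-entry : ∀ {k} (i j : Fin k) {a b} → constP a ≈ b →
    (if does (i ≟F j) then XP else []) +P negP (constP a) ≈ XP * δ (toℕ i) (toℕ j) + - b
  charPoly-entry i j {a} {b} a≈b = trans (+P≈+ _ _)
    (+-cong diagonal (trans (negP≈- (constP a)) (-‿cong a≈b)))
    where
    diagonal : (if does (i ≟F j) then XP else []) ≈ XP * δ (toℕ i) (toℕ j)
    diagonal with i ≟F j
    ... | yes ≡.refl = sym (trans (*-congˡ (reflexive (δ-refl (toℕ i)))) (*-identityʳ XP))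
    ... | no  i≢j    = sym (trans (*-congˡ (δ-≢ (i≢j ∘ toℕ-injective))) (zeroʳ XP))

  extend : ∀ {a} {A : Set a} {k} → A → (Fin k → A) → ℕ → A
  extend {k = zero}  d f i       = d
  extend {k = suc k} d f zero    = f zero
  extend {k = suc k} d f (suc i) = extend d (f ∘ suc) i

  extend-toℕ : ∀ {a} {A : Set a} {k} d (f : Fin k → A) i → extend d f (toℕ i) ≡ f i
  extend-toℕ d f zero    = ≡.refl
  extend-toℕ d f (suc i) = extend-toℕ d (f ∘ suc) i

  entries : ∀ {k} → Mat k → ℕ → ℕ → F
  entries M r = extend 𝕂.0# (extend (λ _ → 𝕂.0#) M r)

  entries-toℕ : ∀ {k} (M : Mat k) i j → entries M (toℕ i) (toℕ j) ≡ M i j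
  entries-toℕ M i j = ≡.trans (extend-toℕ 𝕂.0# _ j) (cong (λ v → v j) (extend-toℕ (λ _ → 𝕂.0#) M i))

  charPoly≈charDet : ∀ {k} (M : Mat k) → charPoly M ≈ charDet k (entries M)
  charPoly≈charDet {k} M = detP≈det k _ (charEntry (entries M)) λ i j →
    charPoly-entry i j (reflexive (cong constP (≡.sym (entries-toℕ M i j))))

  Deg≤-charPoly : ∀ {k} (M : Mat k) → Deg≤ k (charPoly M)
  Deg≤-charPoly {k} M = Deg≤-resp (charPoly≈charDet M) (Deg≤-charDet k (entries M))

  charPoly-monic : ∀ {k} (M : Mat k) → coeff (charPoly M) k ≡ 𝕂.1#
  charPoly-monic {k} M = ≡.trans (coeff≡ (charPoly≈charDet M) k) (charDet-monic k (entries M))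

  _≗₂_ : ∀ {k} → Mat k → Mat k → Set
  M ≗₂ N = ∀ i j → M i j ≡ N i j

  charPoly-cong : ∀ {k} {M N : Mat k} → M ≗₂ N → charPoly M ≈ charPoly N
  charPoly-cong {k} {M} {N} M≗N = trans
    (detP≈det k _ (charEntry (entries N)) λ i j → charPoly-entry i j
      (reflexive (cong constP (≡.trans (M≗N i j) (≡.sym (entries-toℕ N i j))))))
    (sym (charPoly≈charDet N))

  -- The characteristic polynomial of a TSR matrix.

  coeff-drop : ∀ i g j → coeff (List.drop i g) j ≡ coeff g (i ℕ.+ j)
  coeff-drop zero    g       j = ≡.refl
  coeff-drop (suc i) []      j = ≡.refl
  coeff-drop (suc i) (a ∷ g) j = coeff-drop i g j

  drop-step : ∀ i g → List.drop i g ≈ constP (coeff g i) + XP * List.drop (suc i) g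
  drop-step i g = sym (trans (+-congˡ (X*≈shift (List.drop (suc i) g))) (mk≋ λ where
    zero    → ≡.trans (coeff-+ (constP (coeff g i)) _ 0) (≡.trans (𝕂.+-identityʳ _)
                (≡.sym (≡.trans (coeff-drop i g 0) (cong (coeff g) (ℕ.+-identityʳ i)))))
    (suc j) → ≡.trans (coeff-+ (constP (coeff g i)) _ (suc j)) (≡.trans (𝕂.+-identityˡ _)
                (≡.trans (coeff-drop (suc i) g j)
                  (≡.sym (≡.trans (coeff-drop i g (suc j)) (cong (coeff g) (ℕ.+-suc i j))))))))

  -- The body of `tsr` after the indices have been decomposed, so that the cases can be examined
  -- without `remQuot`.
  blockEntry : ∀ {m n} → (Fin n → F) → Mat m → Fin n → Fin m → Fin n → Fin m → F
  blockEntry {n = n} c B i a j b =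
    if suc (toℕ j) ℕ.≡ᵇ n
    then c i 𝕂.* B a b
    else (if (toℕ i ℕ.≡ᵇ suc (toℕ j)) ∧ does (a ≟F b) then 𝕂.1# else 𝕂.0#)

  module _ (m n' : ℕ) .{{_ : NonZero m}} (g : Poly) (B : Mat m) where
    private
      n p : ℕ
      n = suc n'
      p = n' ℕ.* m

      β : ℕ → ℕ → F
      β = entries B
    open BlockCompanion m n' (λ i → constP (coeff g i)) (λ a b → constP (β a b))
      using (companion; det-charMatrix)

    module _ (c : Fin n → F) (c≡g : ∀ i → c i ≡ coeff g (toℕ i)) where

      index : Fin n → Fin m → ℕ
      index i a = toℕ i ℕ.* m ℕ.+ toℕ a

      -- Left of the last block column, uniqueness of quotient and remainder identifies the
      -- condition i = j + 1 and a = b with the single equation i m + a = (j + 1) m + b tested by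
      -- `δ`.
      blockEntry≈companion : ∀ i a j b → constP (blockEntry c B i a j b) ≈ companion (index i a) (index j b)
      blockEntry≈companion i a j b with suc (toℕ j) ℕ.≡ᵇ n in j-last
      ... | true = begin
        constP (c i 𝕂.* B a b)
          ≈⟨ constP-* (c i) (B a b) ⟩
        constP (c i) * constP (B a b)
          ≡⟨ cong₂ (λ x y → constP x * constP y)
               (≡.trans (c≡g i) (cong (coeff g) (≡.sym (block-/ m (toℕ i) (toℕ<n a)))))
               (≡.trans (≡.sym (entries-toℕ B a b)) (cong (λ r → β r (toℕ b)) (≡.sym (block-% m (toℕ i) (toℕ<n a))))) ⟩
        constP (coeff g (index i a / m)) * constP (β (index i a % m) (toℕ b))
          ≡⟨ juxtapose-+ p (toℕ b) ⟨
        companion (index i a) (p ℕ.+ toℕ b)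
          ≡⟨ cong (λ k → companion (index i a) (k ℕ.* m ℕ.+ toℕ b))
               (ℕ.suc-injective (ℕ.≡ᵇ⇒≡ (suc (toℕ j)) n (subst Bool.T (≡.sym j-last) _))) ⟨
        companion (index i a) (index j b) ∎
      ... | false = begin
        constP (if (toℕ i ℕ.≡ᵇ suc (toℕ j)) ∧ does (a ≟F b) then 𝕂.1# else 𝕂.0#)
          ≈⟨ shifted ⟩
        δ (index i a) (suc (toℕ j) ℕ.* m ℕ.+ toℕ b)
          ≡⟨ cong (δ (index i a)) (ℕ.+-assoc m (toℕ j ℕ.* m) (toℕ b)) ⟩
        δ (index i a) (m ℕ.+ index j b)
          ≡⟨ juxtapose-< left-column ⟨
        companion (index i a) (index j b) ∎
        where
        j≢n' : toℕ j ≢ n'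
        j≢n' j≡n' with () ← subst Bool.T j-last (ℕ.≡⇒≡ᵇ (suc (toℕ j)) n (cong suc j≡n'))
        left-column : index j b < p
        left-column = ℕ.<-≤-trans (ℕ.+-monoʳ-< (toℕ j ℕ.* m) (toℕ<n b))
          (ℕ.≤-trans (ℕ.≤-reflexive (ℕ.+-comm (toℕ j ℕ.* m) m))
            (ℕ.*-monoˡ-≤ m (ℕ.≤∧≢⇒< (ℕ.≤-pred (toℕ<n j)) j≢n')))
        shifted : constP (if (toℕ i ℕ.≡ᵇ suc (toℕ j)) ∧ does (a ≟F b) then 𝕂.1# else 𝕂.0#) ≈
                  δ (index i a) (suc (toℕ j) ℕ.* m ℕ.+ toℕ b)
        shifted with toℕ i ℕ.≡ᵇ suc (toℕ j) in i≟sj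
        ... | false = trans constP-0 (sym (δ-≢ λ eq → false≢true (subst Bool.T i≟sj (ℕ.≡⇒≡ᵇ (toℕ i) (suc (toℕ j))
                (≡.trans (≡.sym (block-/ m (toℕ i) (toℕ<n a)))
                  (≡.trans (cong (_/ m) eq) (block-/ m (suc (toℕ j)) (toℕ<n b))))))))
          where
          false≢true : Bool.T false → ⊥
          false≢true ()
        ... | true with a ≟F b
        ...   | yes ≡.refl = reflexive (≡.sym (≡.trans
                  (cong (λ k → δ (index i a) (k ℕ.* m ℕ.+ toℕ a))
                    (≡.sym (ℕ.≡ᵇ⇒≡ (toℕ i) (suc (toℕ j)) (subst Bool.T (≡.sym i≟sj) _))))
                  (δ-refl (index i a))))
        ...   | no a≢b = trans constP-0 (sym (δ-≢ λ eq → a≢b (toℕ-injective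
                  (≡.trans (≡.sym (block-% m (toℕ i) (toℕ<n a)))
                    (≡.trans (cong (_% m) eq) (block-% m (suc (toℕ j)) (toℕ<n b)))))))

      toℕ-index : ∀ (r : Fin (n ℕ.* m)) → index (proj₁ (remQuot {n} m r)) (proj₂ (remQuot {n} m r)) ≡ toℕ r
      toℕ-index r = ≡.trans (cong (ℕ._+ toℕ a) (ℕ.*-comm (toℕ i) m))
        (≡.trans (≡.sym (toℕ-combine i a)) (cong toℕ (combine-remQuot {n} m r)))
        where
        i = proj₁ (remQuot {n} m r)
        a = proj₂ (remQuot {n} m r)

      tsr≈companion : ∀ r s → constP (tsr m n c B r s) ≈ companion (toℕ r) (toℕ s)
      tsr≈companion r s = trans
        (blockEntry≈companion (proj₁ (remQuot {n} m r)) (proj₂ (remQuot {n} m r))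
                              (proj₁ (remQuot {n} m s)) (proj₂ (remQuot {n} m s)))
        (reflexive (cong₂ companion (toℕ-index r) (toℕ-index s)))

      charPoly-tsr : (∀ i → n ≤ i → coeff g i ≡ 𝕂.0#) →
        charPoly (tsr m n c B) ≈ homP g (XP ^ n) m (charPoly B)
      charPoly-tsr g-deg = begin
        charPoly (tsr m n c B)
          ≈⟨ detP≈det (n ℕ.* m) _ (λ r s → XP * δ r s + - companion r s)
               (λ r s → charPoly-entry r s (tsr≈companion r s)) ⟩
        det (m ℕ.+ p) (λ r s → XP * δ r s + - companion r s)
          -- The Horner tails of g at X are the tails of its coefficient list: tail 0 is g itself,
          -- and the degree bound makes tail n zero.
          ≈⟨ det-charMatrix XP (λ i → List.drop i g) (λ {i} _ → drop-step i g)
               (mk≋ λ j → ≡.trans (coeff-drop n g j) (g-deg _ (ℕ.m≤m+n n j))) ⟩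
        det m (λ a b → XP ^ n * δ a b + - (g * constP (β a b)))
          ≈⟨ homP-charDet g (XP ^ n) m β ⟨
        homP g (XP ^ n) m (charDet m β)
          ≈⟨ homP-cong g (XP ^ n) m (charPoly≈charDet B) ⟨
        homP g (XP ^ n) m (charPoly B) ∎

  -- Decompositions as homogenizations.

  ∑-snoc : ∀ k f → ∑ (suc k) f ≈ ∑ k f + f k
  ∑-snoc zero    f = trans (∑-suc 0 f) (trans (+-comm _ _)
    (+-congʳ (trans (∑-zero 0 λ ()) (sym (∑-zero 0 λ ())))))
  ∑-snoc (suc k) f = trans (∑-suc (suc k) f) (trans (+-congˡ (∑-snoc k (f ∘ suc)))
    (trans (sym (+-assoc _ _ _)) (+-congʳ (sym (∑-suc k f)))))

  sumP≈∑ : ∀ k f → sumP k f ≈ ∑ k f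
  sumP≈∑ zero    f = sym (∑-zero 0 λ ())
  sumP≈∑ (suc k) f = trans (+P≈+ _ _) (trans (+-congʳ (sumP≈∑ k f)) (sym (∑-snoc k f)))

  homogenize≈∑ : ∀ g Y d u → homogenize g Y d u ≈ ∑ (suc d) (λ i → constP (u i) * (Y ^ i * g ^ (d ℕ.∸ i)))
  homogenize≈∑ g Y zero    u = sym (trans (∑-suc 0 _) (trans (+-cong
    (trans (*-congˡ (*-identityˡ 1#)) (*-identityʳ _)) (∑-zero 0 λ ())) (+-identityʳ _)))
  homogenize≈∑ g Y (suc d) u = begin
    constP (u 0) * g ^ suc d + Y * homogenize g Y d (u ∘ suc)
      ≈⟨ +-cong (*-congˡ (sym (*-identityˡ _))) (*-congˡ (homogenize≈∑ g Y d (u ∘ suc))) ⟩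
    constP (u 0) * (1# * g ^ suc d) + Y * ∑ (suc d) (λ i → constP (u (suc i)) * (Y ^ i * g ^ (d ℕ.∸ i)))
      ≈⟨ +-congˡ (trans (*-distribˡ-∑ (suc d) Y _) (∑-cong (suc d) λ {i} _ →
           solve 4 (λ y a b c → y :* (a :* (b :* c)) := a :* ((y :* b) :* c)) refl
             Y (constP (u (suc i))) (Y ^ i) (g ^ (d ℕ.∸ i)))) ⟩
    constP (u 0) * (1# * g ^ suc d) + ∑ (suc d) (λ i → constP (u (suc i)) * (Y ^ suc i * g ^ (d ℕ.∸ i)))
      ≈⟨ ∑-suc (suc d) _ ⟨
    ∑ (suc (suc d)) (λ i → constP (u i) * (Y ^ i * g ^ (suc d ℕ.∸ i))) ∎

  decompPoly≈homP : ∀ m n g h → decompPoly m n g h ≈ homP g (XP ^ n) m h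
  decompPoly≈homP m n g h = begin
    decompPoly m n g h
      ≈⟨ sumP≈∑ (suc m) _ ⟩
    ∑ (suc m) (λ i → scaleP (coeff h i) ((XP ^P (n ℕ.* i)) *P (g ^P (m ℕ.∸ i))))
      ≈⟨ ∑-cong (suc m) (λ {i} _ → trans (scaleP≈* (coeff h i) _) (*-congˡ (trans (*P≈* _ _)
           (*-cong (trans (^P≈^ XP (n ℕ.* i)) (sym (^-assocʳ XP n i))) (^P≈^ g (m ℕ.∸ i)))))) ⟩
    ∑ (suc m) (λ i → constP (coeff h i) * ((XP ^ n) ^ i * g ^ (m ℕ.∸ i)))
      ≈⟨ homogenize≈∑ g (XP ^ n) m (coeff h) ⟨
    homP g (XP ^ n) m h ∎

  open import Algebra.Definitions.RawSemiring (Semiring.rawSemiring 𝕂.semiring) using () renaming (_^_ to _^ᴷ_) public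

  coeff₀-^ : ∀ p k → coeff (p ^ k) 0 ≡ coeff p 0 ^ᴷ k
  coeff₀-^ p zero    = ≡.refl
  coeff₀-^ p (suc k) = ≡.trans (coeff-* p (p ^ k) 0) (cong (coeff p 0 𝕂.*_) (coeff₀-^ p k))

  -- Every summand except the one for i = 0 contains a factor Y, which vanishes at 0.
  coeff₀-homogenize : ∀ g Y d u → coeff Y 0 ≡ 𝕂.0# → coeff (homogenize g Y d u) 0 ≡ u 0 𝕂.* coeff g 0 ^ᴷ d
  coeff₀-homogenize g Y zero    u Y₀≡0 = ≡.sym (𝕂.*-identityʳ _)
  coeff₀-homogenize g Y (suc d) u Y₀≡0 = ≡.trans (coeff-+ (constP (u 0) * g ^ suc d) (Y * homogenize g Y d (u ∘ suc)) 0)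
    (≡.trans (cong₂ 𝕂._+_
      (≡.trans (coeff-* (constP (u 0)) (g ^ suc d) 0) (cong (u 0 𝕂.*_) (coeff₀-^ g (suc d))))
      (≡.trans (coeff-* Y (homogenize g Y d (u ∘ suc)) 0) (≡.trans (𝕂.*-congʳ Y₀≡0) (𝕂.zeroˡ _))))
      (𝕂.+-identityʳ _))

-- Comparing counts through a relation.

any-─ : ∀ {A : Set} {P Q : A → Set} {xs} (p : Any P xs) → (∀ {x} → P x → ¬ Q x) → Any Q xs → Any Q (xs ─ p)
any-─ (here px) disjoint (here qx) = ⊥-elim (disjoint px qx)
any-─ (here px) disjoint (there q) = q
any-─ (there p) disjoint (here qx) = here qx
any-─ (there p) disjoint (there q) = there (any-─ p disjoint q)

-- The partner of the first element is deleted from `ys`. No later element has that partner, so each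
-- of them still finds one in the shorter list.
length-≤ : ∀ {A B : Set} (R : A → B → Set) {xs ys} →
  AllPairs (λ x x' → ∀ y → R x y → ¬ R x' y) xs → All (λ x → Any (R x) ys) xs → length xs ≤ length ys
length-≤ R []               []              = z≤n
length-≤ R {x ∷ xs} {ys} (x# ∷ xs#) (x∈ ∷ xs∈) = subst (suc (length xs) ≤_) (≡.sym (length-removeAt′ ys (Any.index x∈)))
  (s≤s (length-≤ R xs# (All.zipWith (λ (x#x' , x'∈) → any-─ x∈ (λ {y} → x#x' y) x'∈) (x# , xs∈))))

count-≤ : ∀ {A B : Set} (R : A → B → Set) (p : A → Bool) (q : B → Bool) xs ys →
  AllPairs (λ x x' → ∀ y → R x y → ¬ R x' y) xs →
  (∀ x → Bool.T (p x) → Any (λ y → R x y × Bool.T (q y)) ys) → countB p xs ≤ countB q ys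
count-≤ R p q xs ys distinct match = length-≤ R (AllPairs.filter⁺ (Bool.T? ∘ p) distinct)
  (All.map matched (All.all-filter (Bool.T? ∘ p) xs))
  where
  matched : ∀ {x} → Bool.T (p x) → Any (R x) (filter (Bool.T? ∘ q) ys)
  matched {x} px with y , y∈ys , Rxy , qy ← find (match x px) = lose (∈-filter⁺ (Bool.T? ∘ q) y∈ys qy) Rxy

-- The relation is a parameter because the construction is applied twice: to rows, with equality of
-- field elements, and then to matrices, with pointwise equality of rows.
module _ {A : Set} (_~_ : A → A → Set) {xs : List A} where

  allFuns-distinct : AllPairs (λ x y → ¬ x ~ y) xs → ∀ k →
    AllPairs (λ u v → ¬ (∀ i → u i ~ v i)) (allFuns xs k)
  allFuns-distinct distinct zero    = [] ∷ []
  allFuns-distinct distinct (suc k) = AllPairs.concat⁺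
    (All.map⁺ (All.universal (λ x → AllPairs.map⁺
      (AllPairs.map (λ u≁v u~v → u≁v (u~v ∘ suc)) (allFuns-distinct distinct k))) xs))
    (AllPairs.map⁺ (AllPairs.map (λ x≁y → All.map⁺ (All.universal (λ u → All.map⁺
      (All.universal (λ v u~v → x≁y (u~v zero)) (allFuns xs k))) (allFuns xs k))) distinct))

  allFuns-complete : (∀ x → Any (x ~_) xs) → ∀ k (v : Fin k → A) → Any (λ u → ∀ i → v i ~ u i) (allFuns xs k)
  allFuns-complete complete zero    v = here λ ()
  allFuns-complete complete (suc k) v = Any.concatMap⁺ _ (Any.map
    (λ v₀~x → Any.map⁺ (Any.map (λ v~u → λ { zero → v₀~x ; (suc i) → v~u i }) (allFuns-complete complete k (v ∘ suc))))
    (complete (v zero)))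

allFinB⁺ : ∀ {k} {p : Fin k → Bool} → (∀ i → Bool.T (p i)) → Bool.T (allFinB p)
allFinB⁺ {zero}  all = _
allFinB⁺ {suc k} all = Equivalence.from T-∧ (all zero , allFinB⁺ (all ∘ suc))

allFinB⁻ : ∀ {k} {p : Fin k → Bool} → Bool.T (allFinB p) → ∀ i → Bool.T (p i)
allFinB⁻ all zero    = proj₁ (Equivalence.to T-∧ all)
allFinB⁻ all (suc i) = allFinB⁻ (proj₂ (Equivalence.to T-∧ all)) i

-- Matching TSR matrices with their blocks.

module Counting (𝔽 : FiniteField) where
  open Over 𝔽
  open PolynomialRing 𝔽
  open Homogenization 𝔽
  open CharacteristicPolynomial 𝔽
  open CommutativeRing fieldRing using (_*_; 0#; 1#; zeroˡ; zeroʳ; *-identityˡ; *-identityʳ)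
  open CommutativeRing polyRing using () renaming (_≈_ to _≈ᴾ_; sym to ≈-sym; trans to ≈-trans)
  open import Algebra.Solver.Ring.NaturalCoefficients.Default (CommutativeRing.commutativeSemiring fieldRing)
    using (solve; _:=_; _:*_)
  open Determinant polyRing using (_^_)
  open FiniteField 𝔽 using (_⁻¹; inverse; elements; complete; unique)

  eqB⁺ : ∀ {x y} → x ≡ y → Bool.T (eqB x y)
  eqB⁺ {x} {y} x≡y with FiniteField._≟_ 𝔽 x y
  ... | yes _  = _
  ... | no x≢y = x≢y x≡y

  eqB⁻ : ∀ {x y} → Bool.T (eqB x y) → x ≡ y
  eqB⁻ {x} {y} eq with FiniteField._≟_ 𝔽 x y
  ... | yes x≡y = x≡y

  allMats-distinct : ∀ k → AllPairs (λ M N → ¬ M ≗₂ N) (allMats k)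
  allMats-distinct k = allFuns-distinct _ (allFuns-distinct _≡_ unique k) k

  allMats-complete : ∀ {k} (M : Mat k) → Any (M ≗₂_) (allMats k)
  allMats-complete {k} M = allFuns-complete _ (allFuns-complete _≡_ complete k) k M

  -- Only the products cᵢ B enter the matrix. Assuming no more than their equality also covers the
  -- rescaling of (c, B) by a nonzero constant.
  tsr-cong : ∀ {m n c c' B B'} → (∀ i a b → c i * B a b ≡ c' i * B' a b) → tsr m n c B ≗₂ tsr m n c' B'
  tsr-cong {m} {n} eq r s = cong (λ x → if suc (toℕ (proj₁ (remQuot {n} m s))) ℕ.≡ᵇ n then x else _)
    (eq (proj₁ (remQuot {n} m r)) (proj₂ (remQuot {n} m r)) (proj₂ (remQuot {n} m s)))

  tsr-lastColumn : ∀ {m n} c (B : Mat m) i a b →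
    tsr m (suc n) c B (combine i a) (combine (Fin.fromℕ n) b) ≡ c i * B a b
  tsr-lastColumn {n = n} c B i a b = ≡.trans
    (cong₂ (λ x y → blockEntry c B (proj₁ x) (proj₂ x) (proj₁ y) (proj₂ y))
      (remQuot-combine i a) (remQuot-combine (Fin.fromℕ n) b))
    (if-true (≡.trans (cong (ℕ._≡ᵇ n) (toℕ-fromℕ n)) (≡ᵇ-refl n)))
    where
    if-true : ∀ {b} {x y : F} → b ≡ true → (if b then x else y) ≡ x
    if-true ≡.refl = ≡.refl

  inTSRB⁻ : ∀ {m n} M → Bool.T (inTSRB m n M) → ∃₂ λ c B → M ≗₂ tsr m n c B
  inTSRB⁻ {m} {n} M M∈ with Any.satisfied (Any.any⁻ _ (allFuns elements n) M∈)
  ... | c , M∈c with Any.satisfied (Any.any⁻ _ (allMats m) M∈c)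
  ...   | B , M≡ = c , B , λ i j → eqB⁻ (allFinB⁻ (allFinB⁻ M≡ i) j)

  inTSRB⁺ : ∀ {m n} M c B → M ≗₂ tsr m n c B → Bool.T (inTSRB m n M)
  inTSRB⁺ {m} {n} M c B M≗ = Any.any⁺ _ (Any.map (λ c≗c' → Any.any⁺ _ (Any.map
    (λ B≗B' → allFinB⁺ λ i → allFinB⁺ λ j → eqB⁺ (≡.trans (M≗ i j)
      (tsr-cong (λ i a b → cong₂ _*_ (c≗c' i) (B≗B' a b)) i j)))
    (allMats-complete B))) (allFuns-complete _≡_ complete n c))

  coeff-tabulate : ∀ {n} (c : Fin n → F) i → coeff (List.tabulate c) (toℕ i) ≡ c i
  coeff-tabulate c zero    = ≡.refl
  coeff-tabulate c (suc i) = coeff-tabulate (c ∘ suc) i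

  coeff-tabulate-≥ : ∀ {n} (c : Fin n → F) i → n ≤ i → coeff (List.tabulate c) i ≡ 0#
  coeff-tabulate-≥ {zero}  c i       _         = ≡.refl
  coeff-tabulate-≥ {suc n} c (suc i) (s≤s n≤i) = coeff-tabulate-≥ (c ∘ suc) i n≤i

  1^ᴷn≡1 : ∀ n → 1# ^ᴷ n ≡ 1#
  1^ᴷn≡1 zero    = ≡.refl
  1^ᴷn≡1 (suc n) = ≡.trans (*-identityˡ _) (1^ᴷn≡1 n)

  module _ (m' n' : ℕ) {f g h : Poly} (unique-decomp : IsUniqueDecomp (suc m') (suc n') f g h) where
    private
      m n : ℕ
      m = suc m'
      n = suc n'

      decomp : IsDecomp m n f g h
      decomp = proj₁ unique-decomp

      h₀≢0 : ¬ coeff h 0 ≡ 0#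
      h₀≢0 = proj₁ (proj₂ (proj₂ decomp))

      g-deg : ∀ i → n ≤ i → coeff g i ≡ 0#
      g-deg = proj₁ (proj₂ (proj₂ (proj₂ decomp)))

      g₀≡1 : coeff g 0 ≡ 1#
      g₀≡1 = proj₁ (proj₂ (proj₂ (proj₂ (proj₂ decomp))))

    f≈homP : f ≈ᴾ homP g (XP ^ n) m h
    f≈homP = ≈-trans (≈P⇒≋ {f} {decompPoly m n g h} (proj₂ (proj₂ (proj₂ (proj₂ (proj₂ decomp)))))) (decompPoly≈homP m n g h)

    f₀-homP : ∀ g' h' → f ≈ᴾ homP g' (XP ^ n) m h' → coeff f 0 ≡ coeff h' 0 * coeff g' 0 ^ᴷ m
    f₀-homP g' h' f≈ = ≡.trans (coeff≡ f≈ 0) (coeff₀-homogenize g' (XP ^ n) m (coeff h')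
      (≡.trans (coeff-* XP (XP ^ n') 0) (zeroˡ _)))

    -- Since g(0) = 1, f(0) = h(0).
    f₀≢0 : ¬ coeff f 0 ≡ 0#
    f₀≢0 f₀≡0 = h₀≢0 (≡.trans (≡.sym (≡.trans (f₀-homP g h f≈homP)
      (≡.trans (cong (λ a → coeff h 0 * a ^ᴷ m) g₀≡1)
        (≡.trans (cong (coeff h 0 *_) (1^ᴷn≡1 m)) (*-identityʳ _))))) f₀≡0)

    γ : Fin n → F
    γ i = coeff g (toℕ i)

    charPoly-tsr-γ : ∀ B → charPoly B ≈P h → charPoly (tsr m n γ B) ≈ᴾ f
    charPoly-tsr-γ B χ≈h = ≈-trans (charPoly-tsr m n' g B γ (λ _ → ≡.refl) g-deg)
      (≈-trans (homP-cong g (XP ^ n) m (≈P⇒≋ {charPoly B} {h} χ≈h)) (≈-sym f≈homP))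

    -- Since g(0) = 1, the block can be read off unchanged at the top of the last block column.
    tsr-γ-injective : ∀ {B B'} → tsr m n γ B ≗₂ tsr m n γ B' → B ≗₂ B'
    tsr-γ-injective {B} {B'} eq a b = ≡.trans (≡.sym (γ₀* (B a b))) (≡.trans
      (≡.trans (≡.sym (tsr-lastColumn {m} {n'} γ B zero a b)) (≡.trans (eq (combine {n} zero a) (combine (Fin.fromℕ n') b)) (tsr-lastColumn {m} {n'} γ B' zero a b)))
      (γ₀* (B' a b)))
      where
      γ₀* : ∀ x → γ zero * x ≡ x
      γ₀* x = ≡.trans (cong (_* x) g₀≡1) (*-identityˡ x)

    -- f(0) ≠ 0 forces c₀ ≠ 0, so (c , B) can be replaced by (c / c₀ , c₀ B), which
    -- yields a decomposition of f.
    normalize : ∀ M c B → M ≗₂ tsr m n c B → charPoly M ≈P f →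
      ∃ λ B' → M ≗₂ tsr m n γ B' × charPoly B' ≈P h
    normalize M c B M≗ χ≈f = B' , (λ r s → ≡.trans (M≗' r s) (tsr-cong (λ i a b → cong (_* B' a b) (c'≡γ i)) r s)) ,
      -- Both halves of uniqueness are used: equality of the h-parts here, and equality of the
      -- g-parts to replace `c'` by `γ`.
      proj₂ (proj₂ unique-decomp g' χ' isDecomp)
      where
      -- Stated for every pair that represents `M`, as it is applied to the given pair and to the
      -- rescaled one.
      f≈ : ∀ c B → M ≗₂ tsr m n c B → f ≈ᴾ homP (List.tabulate c) (XP ^ n) m (charPoly B)
      f≈ c B M≗ = ≈-trans (≈-sym (≈P⇒≋ {charPoly M} {f} χ≈f)) (≈-trans (charPoly-cong M≗)
        (charPoly-tsr m n' (List.tabulate c) B c (λ i → ≡.sym (coeff-tabulate c i)) (coeff-tabulate-≥ c)))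

      c₀ : F
      c₀ = c zero

      c₀≢0 : ¬ c₀ ≡ 0#
      -- f(0) is the constant term of the characteristic polynomial of `B` times the m-th power of
      -- `c₀`, and m ≥ 1 exposes a factor `c₀`.
      c₀≢0 c₀≡0 = f₀≢0 (≡.trans (f₀-homP (List.tabulate c) (charPoly B) (f≈ c B M≗))
        (≡.trans (cong (coeff (charPoly B) 0 *_) (≡.trans (cong (_* (c₀ ^ᴷ m')) c₀≡0) (zeroˡ _))) (zeroʳ _)))

      c' : Fin n → F
      c' i = c i * (c₀ ⁻¹)

      B' : Mat m
      B' a b = c₀ * B a b

      g' χ' : Poly
      g' = List.tabulate c'
      χ' = charPoly B'

      M≗' : M ≗₂ tsr m n c' B'
      M≗' r s = ≡.trans (M≗ r s) (tsr-cong (λ i a b → ≡.sym (≡.trans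
        (solve 4 (λ x y z w → (x :* y) :* (z :* w) := (x :* w) :* (z :* y)) ≡.refl (c i) (c₀ ⁻¹) c₀ (B a b))
        (≡.trans (cong ((c i * B a b) *_) (inverse c₀ c₀≢0)) (*-identityʳ _)))) r s)

      f≈' : f ≈ᴾ homP g' (XP ^ n) m χ'
      f≈' = f≈ c' B' M≗'

      isDecomp : IsDecomp m n f g' χ'
      isDecomp = charPoly-monic B' , Deg≤-charPoly B' ,
        (λ χ₀≡0 → f₀≢0 (≡.trans (f₀-homP g' χ' f≈') (≡.trans (cong (_* (coeff g' 0 ^ᴷ m)) χ₀≡0) (zeroˡ _)))) ,
        coeff-tabulate-≥ c' , inverse c₀ c₀≢0 ,
        ≋⇒≈P (≈-trans f≈' (≈-sym (decompPoly≈homP m n g' χ')))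

      c'≡γ : ∀ i → c' i ≡ γ i
      c'≡γ i = ≡.trans (≡.sym (coeff-tabulate c' i)) (coeff≡ (≈P⇒≋ {g'} {g} (proj₁ (proj₂ unique-decomp g' χ' isDecomp))) (toℕ i))

    tsr-match : ∀ M → Bool.T (inTSRB m n M ∧ polyEqB (charPoly M) f) →
      Any (λ B → M ≗₂ tsr m n γ B × Bool.T (polyEqB (charPoly B) h)) (allMats m)
    tsr-match M sel =
      let M∈ , χ≈f = Equivalence.to T-∧ sel
          c , B , M≗ = inTSRB⁻ M M∈
          B' , M≗' , χ≈h = normalize M c B M≗ (Equivalence.to T-≡ χ≈f)
      in Any.map (λ {B″} B'≗B″ →
           (λ r s → ≡.trans (M≗' r s) (tsr-cong (λ i a b → cong (γ i *_) (B'≗B″ a b)) r s)) ,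
           Equivalence.from T-≡ (≋⇒≈P (≈-trans (≈-sym (charPoly-cong B'≗B″)) (≈P⇒≋ {charPoly B'} {h} χ≈h))))
         (allMats-complete {m} B')

    block-match : ∀ B → Bool.T (polyEqB (charPoly B) h) →
      Any (λ M → M ≗₂ tsr m n γ B × Bool.T (inTSRB m n M ∧ polyEqB (charPoly M) f)) (allMats (n ℕ.* m))
    block-match B χ≈h = Any.map (λ {M} ≗M → let M≗ = λ i j → ≡.sym (≗M i j) in
        M≗ , Equivalence.from T-∧ (inTSRB⁺ M γ B M≗ ,
          Equivalence.from T-≡ (≋⇒≈P (≈-trans (charPoly-cong M≗) (charPoly-tsr-γ B (Equivalence.to T-≡ χ≈h))))))
      (allMats-complete {n ℕ.* m} (tsr m n γ B))

    countTSR≡Nχ : countTSR m n f ≡ Nχ m h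
    countTSR≡Nχ = ℕ.≤-antisym
      -- Two matrices matched with the same block both agree with the TSR matrix of that block. In
      -- the reverse direction, blocks matched with the same matrix agree by `tsr-γ-injective`.
      (count-≤ (λ M B → M ≗₂ tsr m n γ B)
        (λ M → inTSRB m n M ∧ polyEqB (charPoly M) f) (λ B → polyEqB (charPoly B) h) (allMats (n ℕ.* m)) (allMats m)
        (AllPairs.map (λ M≇N B M≗ N≗ → M≇N λ i j → ≡.trans (M≗ i j) (≡.sym (N≗ i j))) (allMats-distinct (n ℕ.* m)))
        tsr-match)
      (count-≤ (λ B M → M ≗₂ tsr m n γ B)
        (λ B → polyEqB (charPoly B) h) (λ M → inTSRB m n M ∧ polyEqB (charPoly M) f) (allMats m) (allMats (n ℕ.* m))
        (AllPairs.map (λ B≇B' M M≗ M≗' → B≇B' (tsr-γ-injective λ i j → ≡.trans (≡.sym (M≗ i j)) (M≗' i j))) (allMats-distinct m))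
        block-match)

theorem3p3 : (𝔽 : FiniteField) → let open Over 𝔽 in
    (m n : ℕ) → 0 < m → 0 < n → 1 < m ⊔ n →
    (f g h : Poly) → IsUniqueDecomp m n f g h →
    countTSR m n f ≡ Nχ m h
theorem3p3 𝔽 (suc m') (suc n') _ _ _ f g h = Counting.countTSR≡Nχ 𝔽 m' n'
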